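{- Let $q$ be a prime power and $n$ a positive integer. Then $\kappa_{\leqslant 1}(n,n)=q$ if $q^2\leqslant n\leqslant q^2+q$, and $\kappa_{\leqslant 1}(n,n)=q+1$ if $n=q^2+q+1$.
   Context: $[n]=\{1,\ldots,n\}$. $\kappa_{\leqslant 1}(n,m)$ is the maximum $k$ such that there exists a family of $m$ pairwise distinct $k$-element subsets of $[n]$ any two of which share at most one element. -}

module Defs where

open import Data.Nat using (ℕ; _≤_; _^_)
open import Data.Nat.Primality using (Prime)
open import Data.Fin using (Fin)
open import Data.Fin.Subset using (Subset; ∣_∣; _∩_)
open import Data.Product using (Σ; ∃; _×_)
open import Function.Definitions using (Injective)
open import Relation.Binary.PropositionalEquality using (_≡_; _≢_)

IsPrimePower : ℕ → Set
IsPrimePower q = Σ ℕ λ p → Σ ℕ λ e → Prime p × 1 ≤ e × q ≡ p ^ e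

Admissible : ℕ → ℕ → ℕ → Set
Admissible n m k =
  Σ (Fin m → Subset n) λ F →
    Injective _≡_ _≡_ F
    × (∀ i → ∣ F i ∣ ≡ k)
    × (∀ i j → i ≢ j → ∣ F i ∩ F j ∣ ≤ 1)

IsKappa≤1 : ℕ → ℕ → ℕ → Set
IsKappa≤1 n m k = Admissible n m k × (∀ k′ → Admissible n m k′ → k′ ≤ k)

{-# OPTIONS --safe #-}

-- Upper bound: counting triples (i , x , y) with x, y ∈ F i, where a pair x ≢ y
-- lies in at most one F i, gives k (k - 1) ≤ n - 1.
--
-- Attained by the affine and the projective plane over a field with q = p ^ e
-- elements. Put n = q - 1. In A = 𝔽ₚ[X] / (X ^ n - 1) every element satisfies
-- a ^ q = a, by Frobenius. The product u of the X ^ (n / l) - 1 over the primes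
-- l ∣ n is nonzero, since its constant coefficient is ± 1. For w ≠ 0 the congruence
-- "w a = w b" is a proper quotient of A, in which a becomes 0 or, after
-- replacing w by w a ≠ 0, invertible. Starting at w = u, finitely many such
-- replacements settle all elements that matter; X then still has order n, so
-- Y ^ n - 1 is the product of the Y - X ^ i, and {0 , 1 , X , … , X ^ (n - 1)} is
-- closed under the field operations.
module Submission where

open import Defs
open import Algebra.Bundles using (CommutativeRing)
open import Algebra.Structures using (IsCommutativeRing)
import Algebra.Properties.Semiring.Exp as Exp
open import Level using (0ℓ; _⊔_)
open import Data.Bool.Base using (Bool; true; false; if_then_else_)
open import Data.Fin.Base using (Fin; zero; suc; toℕ; fromℕ; inject₁; inject≤)
open import Data.Fin.Properties using (toℕ<n; toℕ-injective; toℕ-fromℕ; toℕ-inject₁)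
open import Data.List.Base using ([]; _∷_; _++_; tabulate; cartesianProductWith)
open import Data.List.Relation.Unary.All as All using (All; []; _∷_)
import Data.Nat.Base as ℕ
open import Data.Nat.Base using (ℕ; zero; suc; _≤_; _<_; _∸_; z≤n; s≤s; NonZero)
open import Data.Nat.Combinatorics using (_C_; nCn≡1; nC1≡n; nCk+nC[k+1]≡[n+1]C[k+1])
open import Data.Nat.Divisibility
  using (_∣_; _∣?_; divides; m∣m*n; n∣m*n; ∣-refl; ∣n⇒∣m*n; ∣m∣n⇒∣m+n; ∣m+n∣m⇒∣n;
         ∣1⇒≡1; *-cancelʳ-∣; _∣0; ∣⇒≤; >⇒∤)
open import Data.Nat.DivMod using (_%_; _/_; m≡m%n+[m/n]*n; m%n<n)
open import Data.Nat.GCD using (module GCD; module Bézout)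
open import Data.Nat.ListAction using (product)
open import Data.Nat.Primality
  using (Prime; prime?; euclidsLemma; prime⇒nonZero; prime⇒nonTrivial; ¬prime[1])
open import Data.Nat.Primality.Factorisation using (factorise)
import Data.Nat.Properties as ℕ
open import Data.Nat.Solver using (module +-*-Solver)
open import Data.Product.Base using (∃; _×_; _,_; proj₁; proj₂)
open import Data.Sum.Base as Sum using (_⊎_; inj₁; inj₂; [_,_]′)
open import Data.Vec.Base using (Vec; []; _∷_; replicate)
open import Function.Base using (_∘_)
open import Relation.Binary.Definitions using (Decidable; tri<; tri≈; tri>)
open import Relation.Binary.PropositionalEquality as ≡ using (_≡_; _≢_)
open import Relation.Nullary using (¬_; yes; no; does; contradiction)
open import Relation.Nullary.Decidable using (map′; _×-dec_; dec-true; dec-false)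

-- Characteristic p

module _ where
  open import Data.Nat.Base using (_+_; _*_)
  open ≡.≡-Reasoning

  -- The absorption identity. Pascal's rule splits the left coefficient, the induction hypotheses at
  -- `k` and `suc k` turn the pieces into multiples of `suc n`, and Pascal's rule joins these again.
  [1+k]*[1+n]C[1+k] : ∀ n k → suc k * (suc n C suc k) ≡ suc n * (n C k)
  [1+k]*[1+n]C[1+k] zero zero = ≡.refl
  [1+k]*[1+n]C[1+k] zero (suc k) = ℕ.*-zeroʳ (suc (suc k))
  [1+k]*[1+n]C[1+k] (suc n) zero = begin
    1 * (suc (suc n) C 1)  ≡⟨ ≡.cong (1 *_) (nC1≡n (suc (suc n))) ⟩
    1 * suc (suc n)        ≡⟨ ℕ.*-comm 1 (suc (suc n)) ⟩
    suc (suc n) * 1        ∎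
  [1+k]*[1+n]C[1+k] (suc n) (suc k) = begin
    suc (suc k) * (suc (suc n) C suc (suc k))
      ≡⟨ ≡.cong (suc (suc k) *_) (nCk+nC[k+1]≡[n+1]C[k+1] (suc n) (suc k)) ⟨
    suc (suc k) * (c + suc n C suc (suc k))
      ≡⟨ ℕ.*-distribˡ-+ (suc (suc k)) c _ ⟩
    c + suc k * c + suc (suc k) * (suc n C suc (suc k))
      ≡⟨ ≡.cong₂ (λ x y → c + x + y) ([1+k]*[1+n]C[1+k] n k) ([1+k]*[1+n]C[1+k] n (suc k)) ⟩
    c + suc n * (n C k) + suc n * (n C suc k)
      ≡⟨ ℕ.+-assoc c _ _ ⟩
    c + (suc n * (n C k) + suc n * (n C suc k))
      ≡⟨ ≡.cong (c +_) (ℕ.*-distribˡ-+ (suc n) (n C k) (n C suc k)) ⟨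
    c + suc n * (n C k + n C suc k)
      ≡⟨ ≡.cong (λ x → c + suc n * x) (nCk+nC[k+1]≡[n+1]C[k+1] n k) ⟩
    suc (suc n) * c ∎
    where c = suc n C suc k

-- By absorption `suc p` divides `suc k` times the coefficient; being prime and larger than `suc k`,
-- it divides the coefficient.
prime∣pCk : ∀ {p} k → Prime (suc p) → suc k < suc p → suc p ∣ suc p C suc k
prime∣pCk {p} k pr k<p
  with euclidsLemma (suc k) (suc p C suc k) pr
         (≡.subst (suc p ∣_) (≡.sym ([1+k]*[1+n]C[1+k] p k)) (m∣m*n (p C k)))
... | inj₁ p∣k = contradiction p∣k (>⇒∤ k<p)
... | inj₂ p∣C = p∣C

module Frobenius {c ℓ} (R : CommutativeRing c ℓ) where
  open CommutativeRing R hiding (zero)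
  open import Algebra.Properties.CommutativeSemiring.Exp commutativeSemiring
  open import Algebra.Properties.Semiring.Mult semiring renaming (_×_ to _·_)
  open import Algebra.Properties.Semiring.Sum semiring
  import Algebra.Properties.CommutativeSemiring.Binomial commutativeSemiring as Binomial
  open import Algebra.Properties.Group +-group using (inverseʳ-unique)
  open import Relation.Binary.Reasoning.Setoid setoid

  ∣⇒×≈0 : ∀ {p m} → p · 1# ≈ 0# → p ∣ m → ∀ x → m · x ≈ 0#
  ∣⇒×≈0 {p} p≈0 (divides k ≡.refl) x = begin
    (k ℕ.* p) · x        ≈⟨ ×-assocˡ x k p ⟨
    k · (p · x)          ≈⟨ ×-congʳ k (×-congʳ p (*-identityˡ x)) ⟨
    k · (p · (1# * x))   ≈⟨ ×-congʳ k (×-assoc-* p 1# x) ⟨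
    k · ((p · 1#) * x)   ≈⟨ ×-congʳ k (*-congʳ p≈0) ⟩
    k · (0# * x)         ≈⟨ ×-congʳ k (zeroˡ x) ⟩
    k · 0#               ≈⟨ sum-replicate k ⟨
    sum {k} (λ _ → 0#)   ≈⟨ sum-replicate-zero k ⟩
    0#                   ∎

  -- Only the two end terms of the binomial expansion survive, since every coefficient in between is
  -- a multiple of `p`.
  frobenius-+ : ∀ {p} → Prime p → p · 1# ≈ 0# → ∀ x y → (x + y) ^ p ≈ x ^ p + y ^ p
  frobenius-+ {zero} pr p≈0 x y = contradiction ≡.refl (ℕ.≢-nonZero⁻¹ 0 {{prime⇒nonZero pr}})
  frobenius-+ {suc m} pr p≈0 x y = begin
    (x + y) ^ p                                  ≈⟨ Binomial.theorem p x y ⟩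
    term zero + sum (λ i → term (suc i))         ≈⟨ +-congˡ (sum-init-last (λ i → term (suc i))) ⟩
    term zero + (sum (λ i → term (suc (inject₁ i))) + term (suc (fromℕ m)))
      ≈⟨ +-cong bottom (+-cong (trans (sum-cong-≋ middle) (sum-replicate-zero m)) top) ⟩
    y ^ p + (0# + x ^ p)                         ≈⟨ +-congˡ (+-identityˡ _) ⟩
    y ^ p + x ^ p                                ≈⟨ +-comm _ _ ⟩
    x ^ p + y ^ p                                ∎
    where
    p = suc m
    term = Binomial.binomialTerm x y p

    bottom : term zero ≈ y ^ p
    bottom = trans (×-homo-1 _) (*-identityˡ _)

    top : term (suc (fromℕ m)) ≈ x ^ p
    top rewrite toℕ-fromℕ m | nCn≡1 p | ℕ.n∸n≡0 m = trans (×-homo-1 _) (*-identityʳ _)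

    middle : ∀ i → term (suc (inject₁ i)) ≈ 0#
    middle i rewrite toℕ-inject₁ i =
      ∣⇒×≈0 p≈0 (prime∣pCk (toℕ i) pr (s≤s (toℕ<n i))) _

  frobenius^-+ : ∀ {p} → Prime p → p · 1# ≈ 0# → ∀ e x y →
                 (x + y) ^ (p ℕ.^ e) ≈ x ^ (p ℕ.^ e) + y ^ (p ℕ.^ e)
  frobenius^-+ pr p≈0 zero x y =
    trans (*-identityʳ _) (sym (+-cong (*-identityʳ x) (*-identityʳ y)))
  frobenius^-+ {p} pr p≈0 (suc e) x y = begin
    (x + y) ^ (p ℕ.* p ℕ.^ e)                           ≈⟨ ^-assocʳ (x + y) p _ ⟨
    ((x + y) ^ p) ^ (p ℕ.^ e)                           ≈⟨ ^-congˡ (p ℕ.^ e) (frobenius-+ pr p≈0 x y) ⟩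
    (x ^ p + y ^ p) ^ (p ℕ.^ e)                         ≈⟨ frobenius^-+ pr p≈0 e _ _ ⟩
    (x ^ p) ^ (p ℕ.^ e) + (y ^ p) ^ (p ℕ.^ e)           ≈⟨ +-cong (^-assocʳ x p _) (^-assocʳ y p _) ⟩
    x ^ (p ℕ.* p ℕ.^ e) + y ^ (p ℕ.* p ℕ.^ e)           ∎

  -- `q` is kept apart from `p ^ e` so that it can be instantiated by a successor, on which
  -- exponentiation unfolds.
  module FixedPoints {p} (pr : Prime p) (p≈0 : p · 1# ≈ 0#) {q} e (q≡p^e : q ≡ p ℕ.^ e)
                     (0^q≈0 : 0# ^ q ≈ 0#) where

    Fixed : Carrier → Set ℓ
    Fixed x = x ^ q ≈ x

    +-fixed : ∀ {x y} → Fixed x → Fixed y → Fixed (x + y)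
    +-fixed {x} {y} fx fy = begin
      (x + y) ^ q         ≡⟨ ≡.cong ((x + y) ^_) q≡p^e ⟩
      (x + y) ^ (p ℕ.^ e) ≈⟨ frobenius^-+ pr p≈0 e x y ⟩
      x ^ (p ℕ.^ e) + y ^ (p ℕ.^ e) ≡⟨ ≡.cong (λ k → x ^ k + y ^ k) q≡p^e ⟨
      x ^ q + y ^ q       ≈⟨ +-cong fx fy ⟩
      x + y               ∎

    *-fixed : ∀ {x y} → Fixed x → Fixed y → Fixed (x * y)
    *-fixed {x} {y} fx fy = trans (^-distrib-* x y q) (*-cong fx fy)

    -- Additivity of the power map makes `(- x) ^ q` an additive inverse of `x ^ q`, hence of `x`,
    -- whatever the parity of `q`.
    -‿fixed : ∀ {x} → Fixed x → Fixed (- x)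
    -‿fixed {x} fx = inverseʳ-unique x ((- x) ^ q) (begin
      x + (- x) ^ q       ≈⟨ +-congʳ fx ⟨
      x ^ q + (- x) ^ q   ≡⟨ ≡.cong (λ k → x ^ k + (- x) ^ k) q≡p^e ⟩
      x ^ (p ℕ.^ e) + (- x) ^ (p ℕ.^ e) ≈⟨ frobenius^-+ pr p≈0 e x (- x) ⟨
      (x + - x) ^ (p ℕ.^ e) ≡⟨ ≡.cong ((x + - x) ^_) q≡p^e ⟨
      (x + - x) ^ q       ≈⟨ ^-congˡ q (-‿inverseʳ x) ⟩
      0# ^ q              ≈⟨ 0^q≈0 ⟩
      0#                  ∎)

-- The group algebra of a cyclic group

module GroupAlgebra {c ℓ} (B : CommutativeRing c ℓ) (n : ℕ) .{{_ : NonZero n}} where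
  private
    module B = CommutativeRing B
  open B using () renaming (Carrier to ∣B∣; _+_ to _+ᴮ_; -_ to -ᴮ_; 0# to 0ᴮ; 1# to 1ᴮ)
  open import Algebra.Properties.Ring B.ring using (-0#≈0#)
  open import Algebra.Properties.AbelianGroup B.+-abelianGroup using () renaming (⁻¹-∙-comm to -‿+-comm)
  open import Algebra.Properties.CommutativeSemigroup B.+-commutativeSemigroup using (interchange)

  infixl 6 _⊕_
  infixl 7 _⊗_

  -- Elements of B[ℤ/n] are represented by expressions in the generator X, which acts on sequences
  -- as the shift; two of them are identified when they agree on the indicator δ of the multiples of n.
  data Expr : Set where
    𝟘 𝟙 X   : Expr
    _⊕_ _⊗_ : Expr → Expr → Expr
    ⊖_      : Expr → Expr

  infix 4 _≋_
  _≋_ : (f g : ℕ → ∣B∣) → Set ℓ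
  f ≋ g = ∀ k → f k B.≈ g k

  -- With composition as product, associativity and the unit laws hold by reflexivity; commutativity
  -- and left distributivity are left to inductions.
  act : Expr → (ℕ → ∣B∣) → (ℕ → ∣B∣)
  act 𝟘       f k = 0ᴮ
  act 𝟙       f k = f k
  act X       f k = f (suc k)
  act (a ⊕ b) f k = act a f k +ᴮ act b f k
  act (a ⊗ b) f k = act a (act b f) k
  act (⊖ a)   f k = -ᴮ act a f k

  act-cong : ∀ a {f g} → f ≋ g → act a f ≋ act a g
  act-cong 𝟘       f≋g k = B.refl
  act-cong 𝟙       f≋g k = f≋g k
  act-cong X       f≋g k = f≋g (suc k)
  act-cong (a ⊕ b) f≋g k = B.+-cong (act-cong a f≋g k) (act-cong b f≋g k)
  act-cong (a ⊗ b) f≋g k = act-cong a (act-cong b f≋g) k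
  act-cong (⊖ a)   f≋g k = B.-‿cong (act-cong a f≋g k)

  act-0 : ∀ a → act a (λ _ → 0ᴮ) ≋ (λ _ → 0ᴮ)
  act-0 𝟘       k = B.refl
  act-0 𝟙       k = B.refl
  act-0 X       k = B.refl
  act-0 (a ⊕ b) k = B.trans (B.+-cong (act-0 a k) (act-0 b k)) (B.+-identityˡ _)
  act-0 (a ⊗ b) k = B.trans (act-cong a (act-0 b) k) (act-0 a k)
  act-0 (⊖ a)   k = B.trans (B.-‿cong (act-0 a k)) -0#≈0#

  act-+ : ∀ a f g → act a (λ k → f k +ᴮ g k) ≋ (λ k → act a f k +ᴮ act a g k)
  act-+ 𝟘       f g k = B.sym (B.+-identityˡ _)
  act-+ 𝟙       f g k = B.refl
  act-+ X       f g k = B.refl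
  act-+ (a ⊕ b) f g k = B.trans (B.+-cong (act-+ a f g k) (act-+ b f g k)) (interchange _ _ _ _)
  act-+ (a ⊗ b) f g k = B.trans (act-cong a (act-+ b f g) k) (act-+ a _ _ k)
  act-+ (⊖ a)   f g k = B.trans (B.-‿cong (act-+ a f g k)) (B.sym (-‿+-comm _ _))

  act-neg : ∀ a f → act a (λ k → -ᴮ f k) ≋ (λ k → -ᴮ act a f k)
  act-neg 𝟘       f k = B.sym -0#≈0#
  act-neg 𝟙       f k = B.refl
  act-neg X       f k = B.refl
  act-neg (a ⊕ b) f k = B.trans (B.+-cong (act-neg a f k) (act-neg b f k)) (-‿+-comm _ _)
  act-neg (a ⊗ b) f k = B.trans (act-cong a (act-neg b f) k) (act-neg a _ k)
  act-neg (⊖ a)   f k = B.-‿cong (act-neg a f k)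

  act-shift : ∀ a f → act a (f ∘ suc) ≋ act a f ∘ suc
  act-shift 𝟘       f k = B.refl
  act-shift 𝟙       f k = B.refl
  act-shift X       f k = B.refl
  act-shift (a ⊕ b) f k = B.+-cong (act-shift a f k) (act-shift b f k)
  act-shift (a ⊗ b) f k = B.trans (act-cong a (act-shift b f) k) (act-shift a _ k)
  act-shift (⊖ a)   f k = B.-‿cong (act-shift a f k)

  -- Every operator is built from the shift by pointwise sums, negation and composition, and `b`
  -- respects each of these by the preceding lemmas.
  act-comm : ∀ a b f → act a (act b f) ≋ act b (act a f)
  act-comm 𝟘       b f k = B.sym (act-0 b k)
  act-comm 𝟙       b f k = B.refl
  act-comm X       b f k = B.sym (act-shift b f k)
  act-comm (a ⊕ d) b f k =
    B.trans (B.+-cong (act-comm a b f k) (act-comm d b f k)) (B.sym (act-+ b _ _ k))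
  act-comm (a ⊗ d) b f k =
    B.trans (act-cong a (act-comm d b f) k) (act-comm a b _ k)
  act-comm (⊖ a)   b f k = B.trans (B.-‿cong (act-comm a b f k)) (B.sym (act-neg b _ k))

  δ : ℕ → ∣B∣
  δ k = if does (n ∣? k) then 1ᴮ else 0ᴮ

  δ-∣ : ∀ {k} → n ∣ k → δ k ≡ 1ᴮ
  δ-∣ {k} n∣k rewrite dec-true (n ∣? k) n∣k = ≡.refl

  δ-∤ : ∀ {k} → ¬ n ∣ k → δ k ≡ 0ᴮ
  δ-∤ {k} n∤k rewrite dec-false (n ∣? k) n∤k = ≡.refl

  δ-periodic : ∀ k → δ (n ℕ.+ k) ≡ δ k
  δ-periodic k with n ∣? k
  ... | yes n∣k = δ-∣ (∣m∣n⇒∣m+n ∣-refl n∣k)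
  ... | no  n∤k = δ-∤ (λ n∣n+k → n∤k (∣m+n∣m⇒∣n n∣n+k ∣-refl))

  infix 4 _≈_
  _≈_ : Expr → Expr → Set ℓ
  a ≈ b = act a δ ≋ act b δ

  -- Equality is tested on `δ` alone, so `a ≈ a′` says nothing directly about `act b δ`; commuting
  -- the factors lets `a` act on `δ` first.
  ≈-⊗-cong : ∀ {a a′ b b′} → a ≈ a′ → b ≈ b′ → a ⊗ b ≈ a′ ⊗ b′
  ≈-⊗-cong {a} {a′} {b} {b′} a≈a′ b≈b′ k =
    B.trans (act-cong a b≈b′ k) (B.trans (act-comm a b′ δ k)
      (B.trans (act-cong b′ a≈a′ k) (act-comm b′ a′ δ k)))

  isCommutativeRing : IsCommutativeRing _≈_ _⊕_ _⊗_ ⊖_ 𝟘 𝟙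
  isCommutativeRing = record
    { isRing = record
      { +-isAbelianGroup = record
        { isGroup = record
          { isMonoid = record
            { isSemigroup = record
              { isMagma = record
                { isEquivalence = record
                  { refl = λ k → B.refl
                  ; sym = λ p k → B.sym (p k)
                  ; trans = λ p q k → B.trans (p k) (q k) }
                ; ∙-cong = λ p q k → B.+-cong (p k) (q k) }
              ; assoc = λ a b d k → B.+-assoc _ _ _ }
            ; identity = (λ a k → B.+-identityˡ _) , (λ a k → B.+-identityʳ _) }
          ; inverse = (λ a k → B.-‿inverseˡ _) , (λ a k → B.-‿inverseʳ _)
          ; ⁻¹-cong = λ p k → B.-‿cong (p k) }
        ; comm = λ a b k → B.+-comm _ _ }
      ; *-cong = λ {a} {a′} {b} {b′} → ≈-⊗-cong {a} {a′} {b} {b′}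
      ; *-assoc = λ a b d k → B.refl
      ; *-identity = (λ a k → B.refl) , (λ a k → B.refl)
      ; distrib = (λ a b d k → act-+ a _ _ k) , (λ a b d k → B.refl) }
    ; *-comm = λ a b → act-comm a b δ }

  ring : CommutativeRing 0ℓ ℓ
  ring = record { isCommutativeRing = isCommutativeRing }

  open CommutativeRing ring using (_-_; semiring)
  open import Algebra.Properties.Semiring.Exp semiring public using (_^_)
  open import Algebra.Properties.Semiring.Mult semiring using () renaming (_×_ to _·_)
  open import Algebra.Properties.Semiring.Mult B.semiring using () renaming (_×_ to _·ᴮ_)

  act-X^ : ∀ m f k → act (X ^ m) f k ≡ f (m ℕ.+ k)
  act-X^ zero    f k = ≡.refl
  act-X^ (suc m) f k = ≡.trans (act-X^ m f (suc k)) (≡.cong f (ℕ.+-suc m k))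

  X^n≈1 : X ^ n ≈ 𝟙
  X^n≈1 k = B.reflexive (≡.trans (act-X^ n δ k) (δ-periodic k))

  act-· : ∀ m f k → act (m · 𝟙) f k ≡ m ·ᴮ f k
  act-· zero    f k = ≡.refl
  act-· (suc m) f k = ≡.cong (f k +ᴮ_) (act-· m f k)

  characteristic : ∀ m → (∀ x → m ·ᴮ x B.≈ 0ᴮ) → m · 𝟙 ≈ 𝟘
  characteristic m m≈0 k = B.trans (B.reflexive (act-· m δ k)) (m≈0 (δ k))

  -- `X ^ n` commutes with `a` and fixes `δ`. Hence the first `n` values determine an element, which
  -- makes `_≈_` decidable.
  act-periodic : ∀ a i k → act a δ (i ℕ.* n ℕ.+ k) B.≈ act a δ k
  act-periodic a zero    k = B.refl
  act-periodic a (suc i) k = begin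
    act a δ (n ℕ.+ i ℕ.* n ℕ.+ k)       ≡⟨ ≡.cong (act a δ) (ℕ.+-assoc n (i ℕ.* n) k) ⟩
    act a δ (n ℕ.+ (i ℕ.* n ℕ.+ k))     ≡⟨ act-X^ n (act a δ) _ ⟨
    act (X ^ n) (act a δ) (i ℕ.* n ℕ.+ k) ≈⟨ act-comm (X ^ n) a δ _ ⟩
    act a (act (X ^ n) δ) (i ℕ.* n ℕ.+ k) ≈⟨ act-cong a X^n≈1 _ ⟩
    act a δ (i ℕ.* n ℕ.+ k)             ≈⟨ act-periodic a i k ⟩
    act a δ k                           ∎
    where open import Relation.Binary.Reasoning.Setoid B.setoid

  ≈-bounded : ∀ a b → (∀ {k} → k < n → act a δ k B.≈ act b δ k) → a ≈ b
  ≈-bounded a b a≈b k = begin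
    act a δ k                             ≡⟨ ≡.cong (act a δ) k≡ ⟩
    act a δ (k / n ℕ.* n ℕ.+ k % n)       ≈⟨ act-periodic a (k / n) (k % n) ⟩
    act a δ (k % n)                       ≈⟨ a≈b (m%n<n k n) ⟩
    act b δ (k % n)                       ≈⟨ act-periodic b (k / n) (k % n) ⟨
    act b δ (k / n ℕ.* n ℕ.+ k % n)       ≡⟨ ≡.cong (act b δ) k≡ ⟨
    act b δ k                             ∎
    where
    open import Relation.Binary.Reasoning.Setoid B.setoid
    k≡ : k ≡ k / n ℕ.* n ℕ.+ k % n
    k≡ = ≡.trans (m≡m%n+[m/n]*n k n) (ℕ.+-comm (k % n) _)

  ≈-dec : Decidable B._≈_ → Decidable _≈_
  ≈-dec _≟_ a b = map′ (≈-bounded a b) (λ a≈b _ → a≈b _)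
    (ℕ.allUpTo? (λ k → act a δ k ≟ act b δ k) n)

  module _ (1≉0 : ¬ 1ᴮ B.≈ 0ᴮ) where

    -- u is the product of the X ^ (n / l) - 1 over the primes l < m dividing n, and P the product of these l.
    record Separator (m : ℕ) : Set ℓ where
      field
        u           : Expr
        P           : ℕ
        P-primes    : ∀ {l} → Prime l → l ∣ P → l < m
        support     : ∀ {j} → ¬ n ∣ P ℕ.* j → act u δ j B.≈ 0ᴮ
        nonzero     : ¬ act u δ 0 B.≈ 0ᴮ
        divisible   : ∀ {l} d → Prime l → l < m → n ≡ d ℕ.* l → ∃ λ v → u ≈ (X ^ d - 𝟙) ⊗ v

    -- The invariant `support` keeps the constant coefficient alive: for a new prime `m` and `d` = n
    -- / m, the index `d` lies outside the support of `u` because `m` does not divide `P`. So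
    -- multiplying by `X ^ d - 𝟙` merely negates the coefficient at 0.
    separator : ∀ m → Separator m
    separator zero = record
      { u = 𝟙
      ; P = 1
      ; P-primes = λ pr l∣1 → contradiction (≡.subst Prime (∣1⇒≡1 l∣1) pr) ¬prime[1]
      ; support = λ {j} n∤j → B.reflexive (δ-∤ (n∤j ∘ ≡.subst (n ∣_) (≡.sym (ℕ.*-identityˡ j))))
      ; nonzero = λ δ0≈0 → 1≉0 (B.trans (B.reflexive (≡.sym (δ-∣ (n ∣0)))) δ0≈0)
      ; divisible = λ _ _ ()
      }
    separator (suc m) with prime? m ×-dec m ∣? n
    ... | no ¬pm = record
      { u = u
      ; P = P
      ; P-primes = λ pr l∣P → ℕ.m≤n⇒m≤1+n (P-primes pr l∣P)
      ; support = support
      ; nonzero = nonzero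
      ; divisible = λ {l} d pr l<1+m n≡dl → divisible d pr
          (ℕ.≤∧≢⇒< (ℕ.≤-pred l<1+m) λ { ≡.refl → ¬pm (pr , divides d n≡dl) }) n≡dl
      }
      where open Separator (separator m)
    ... | yes (prime-m , divides d n≡dm) = record
      { u = factor ⊗ u
      ; P = m ℕ.* P
      ; P-primes = λ {l} pr l∣mP → [ (λ l∣m → s≤s (∣⇒≤ {{prime⇒nonZero prime-m}} l∣m))
                             , (λ l∣P → ℕ.m≤n⇒m≤1+n (P-primes pr l∣P)) ]′ (euclidsLemma m P pr l∣mP)
      ; support = λ {j} n∤mPj → begin
          act (factor ⊗ u) δ j                ≈⟨ factor-u j ⟩
          act u δ (d ℕ.+ j) +ᴮ -ᴮ act u δ j
            ≈⟨ B.+-cong (support (n∤mPj ∘ shifted)) (B.-‿cong (support (n∤mPj ∘ unshifted))) ⟩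
          0ᴮ +ᴮ -ᴮ 0ᴮ                         ≈⟨ B.-‿inverseʳ 0ᴮ ⟩
          0ᴮ                                  ∎
      ; nonzero = λ fu≈0 → nonzero (begin
          act u δ 0                            ≈⟨ -‿involutive _ ⟨
          -ᴮ (-ᴮ act u δ 0)                    ≈⟨ B.-‿cong (B.+-identityˡ _) ⟨
          -ᴮ (0ᴮ +ᴮ -ᴮ act u δ 0)              ≈⟨ B.-‿cong (B.+-congʳ (support n∤P[d+0])) ⟨
          -ᴮ (act u δ (d ℕ.+ 0) +ᴮ -ᴮ act u δ 0) ≈⟨ B.-‿cong (factor-u 0) ⟨
          -ᴮ act (factor ⊗ u) δ 0              ≈⟨ B.-‿cong fu≈0 ⟩
          -ᴮ 0ᴮ                                ≈⟨ -0#≈0# ⟩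
          0ᴮ                                   ∎)
      ; divisible = divisible′
      }
      where
      open Separator (separator m)
      open import Relation.Binary.Reasoning.Setoid B.setoid
      open import Algebra.Properties.Group B.+-group using () renaming (⁻¹-involutive to -‿involutive)

      factor = X ^ d - 𝟙

      factor-u : ∀ j → act (factor ⊗ u) δ j B.≈ act u δ (d ℕ.+ j) +ᴮ -ᴮ act u δ j
      factor-u j = B.+-congʳ (B.reflexive (act-X^ d (act u δ) j))

      unshifted : ∀ {j} → n ∣ P ℕ.* j → n ∣ m ℕ.* P ℕ.* j
      unshifted {j} n∣Pj = ≡.subst (n ∣_) (≡.sym (ℕ.*-assoc m P j)) (∣n⇒∣m*n m n∣Pj)

      mPd≡Pn : m ℕ.* P ℕ.* d ≡ P ℕ.* n
      mPd≡Pn = ≡.trans (solve 3 (λ m P d → m :* P :* d := P :* (d :* m)) ≡.refl m P d)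
        (≡.cong (P ℕ.*_) (≡.sym n≡dm))
        where open +-*-Solver

      shifted : ∀ {j} → n ∣ P ℕ.* (d ℕ.+ j) → n ∣ m ℕ.* P ℕ.* j
      shifted {j} n∣P[d+j] = ∣m+n∣m⇒∣n
        (≡.subst (n ∣_) (ℕ.*-distribˡ-+ (m ℕ.* P) d j) (unshifted n∣P[d+j]))
        (≡.subst (n ∣_) (≡.sym mPd≡Pn) (n∣m*n P))

      -- Cancelling `d` from d m = n would leave `m` dividing `P`, whose prime divisors are all
      -- below `m`.
      n∤P[d+0] : ¬ n ∣ P ℕ.* (d ℕ.+ 0)
      n∤P[d+0] n∣ = ℕ.<-irrefl ≡.refl (P-primes prime-m (*-cancelʳ-∣ d {{d≢0}} (≡.subst₂ _∣_
        (≡.trans n≡dm (ℕ.*-comm d m)) (≡.cong (P ℕ.*_) (ℕ.+-identityʳ d)) n∣)))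
        where
        d≢0 : NonZero d
        d≢0 = ℕ.m*n≢0⇒m≢0 d {{≡.subst NonZero n≡dm (ℕ.>-nonZero (ℕ.>-nonZero⁻¹ n))}}

      -- For `l` = `m` the required factor is the new one; for smaller `l` it is inherited from `u`
      -- and commuted to the front.
      divisible′ : ∀ {l} d → Prime l → l < suc m → n ≡ d ℕ.* l → ∃ λ v → factor ⊗ u ≈ (X ^ d - 𝟙) ⊗ v
      divisible′ {l} d′ pr l<1+m n≡d′l with l ℕ.≟ m
      ... | yes ≡.refl rewrite ℕ.*-cancelʳ-≡ d′ d l {{prime⇒nonZero pr}} (≡.trans (≡.sym n≡d′l) n≡dm) =
        u , (λ k → B.refl)
      ... | no l≢m with divisible d′ pr (ℕ.≤∧≢⇒< (ℕ.≤-pred l<1+m) l≢m) n≡d′l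
      ...   | v , u≈ = factor ⊗ v ,
              CommutativeRing.trans ring {factor ⊗ u} {factor ⊗ ((X ^ d′ - 𝟙) ⊗ v)} {(X ^ d′ - 𝟙) ⊗ (factor ⊗ v)}
              (act-cong factor u≈) (act-comm factor (X ^ d′ - 𝟙) (act v δ))

-- Localisation and roots of unity

∃-prime-divisor : ∀ c → 1 < c → ∃ λ l → Prime l × l ∣ c
∃-prime-divisor c 1<c with factorise c {{ℕ.>-nonZero (ℕ.<-trans (s≤s z≤n) 1<c)}}
... | record { factors = [] ; isFactorisation = c≡1 } =
  contradiction (≡.sym c≡1) (ℕ.<⇒≢ 1<c)
... | record { factors = l ∷ ls ; isFactorisation = c≡ ; factorsPrime = pr ∷ _ } =
  l , pr , divides (product ls) (≡.trans c≡ (ℕ.*-comm l _))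

module Units {c ℓ} (R : CommutativeRing c ℓ) where
  open CommutativeRing R hiding (zero)
  open import Algebra.Properties.CommutativeSemiring.Exp commutativeSemiring
  open import Relation.Binary.Reasoning.Setoid setoid

  1^n≈1 : ∀ n → 1# ^ n ≈ 1#
  1^n≈1 zero = refl
  1^n≈1 (suc n) = trans (*-identityˡ _) (1^n≈1 n)

  ^-≈1-* : ∀ {x} m k → x ^ m ≈ 1# → x ^ (k ℕ.* m) ≈ 1#
  ^-≈1-* {x} m k x^m≈1 = begin
    x ^ (k ℕ.* m)  ≡⟨ ≡.cong (x ^_) (ℕ.*-comm k m) ⟩
    x ^ (m ℕ.* k)  ≈⟨ ^-assocʳ x m k ⟨
    (x ^ m) ^ k    ≈⟨ ^-congˡ k x^m≈1 ⟩
    1# ^ k         ≈⟨ 1^n≈1 k ⟩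
    1#             ∎

  -- This is g = j b - i a with the negative term moved across: multiplying by the trivial power
  -- `x ^ (i ℕ.* a)` replaces division.
  ^-≈1-Bézout : ∀ {x g a b} i j → g ℕ.+ i ℕ.* a ≡ j ℕ.* b → x ^ a ≈ 1# → x ^ b ≈ 1# → x ^ g ≈ 1#
  ^-≈1-Bézout {x} {g} {a} {b} i j eq xa xb = begin
    x ^ g                      ≈⟨ *-identityʳ _ ⟨
    x ^ g * 1#                 ≈⟨ *-congˡ (^-≈1-* a i xa) ⟨
    x ^ g * x ^ (i ℕ.* a)      ≈⟨ ^-homo-* x g _ ⟨
    x ^ (g ℕ.+ i ℕ.* a)        ≡⟨ ≡.cong (x ^_) eq ⟩
    x ^ (j ℕ.* b)              ≈⟨ ^-≈1-* b j xb ⟩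
    1#                         ∎

  -- Bézout gives `x ^ g ≈ 1#` for the gcd `g` of `d` and `n`. Since g ≤ d < n, the cofactor n / g
  -- has a prime divisor `l`, and n / l is a multiple of `g`.
  ^≈1⇒prime-cofactor : ∀ {x n} d .{{_ : NonZero n}} .{{_ : NonZero d}} → x ^ n ≈ 1# → d < n → x ^ d ≈ 1# →
    ∃ λ l → ∃ λ k → Prime l × n ≡ k ℕ.* l × x ^ k ≈ 1#
  ^≈1⇒prime-cofactor {x} {n} d xn≈1 d<n xd≈1 with Bézout.lemma d n
  ... | Bézout.result g gcd b with GCD.gcd∣n gcd
  ...   | divides m n≡m*g with ∃-prime-divisor m 1<m
    where
    g<n : g < n
    g<n = ℕ.≤-<-trans (∣⇒≤ (GCD.gcd∣m gcd)) d<n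
    1<m : 1 < m
    1<m = ℕ.*-cancelʳ-< g 1 m (≡.subst₂ _<_ (≡.sym (ℕ.*-identityˡ g)) n≡m*g g<n)
  ...     | l , pr , divides k m≡k*l = l , k ℕ.* g , pr , n≡ , ^-≈1-* g k (x^g≈1 b)
    where
    n≡ : n ≡ k ℕ.* g ℕ.* l
    n≡ = ≡.trans n≡m*g (≡.trans (≡.cong (ℕ._* g) m≡k*l)
           (≡.trans (ℕ.*-assoc k l g) (≡.trans (≡.cong (k ℕ.*_) (ℕ.*-comm l g)) (≡.sym (ℕ.*-assoc k g l)))))
    x^g≈1 : Bézout.Identity g d n → x ^ g ≈ 1#
    x^g≈1 (Bézout.+- i j eq) = ^-≈1-Bézout j i eq xn≈1 xd≈1
    x^g≈1 (Bézout.-+ i j eq) = ^-≈1-Bézout i j eq xd≈1 xn≈1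

module Localisation {c ℓ} (R : CommutativeRing c ℓ) (w : CommutativeRing.Carrier R) where
  open CommutativeRing R hiding (zero; isCommutativeRing)
  open import Algebra.Properties.Ring ring using (-‿distribʳ-*)
  open import Algebra.Properties.CommutativeSemigroup *-commutativeSemigroup using (x∙yz≈y∙xz)
  open import Relation.Binary.Reasoning.Setoid setoid

  -- The quotient by the annihilator of w.
  infix 4 _~_
  record _~_ (a b : Carrier) : Set ℓ where
    constructor ⟪_⟫
    field
      *≈* : w * a ≈ w * b

  open _~_ public

  ≈⇒~ : ∀ {a b} → a ≈ b → a ~ b
  ≈⇒~ a≈b = ⟪ *-congˡ a≈b ⟫

  *-cong-~ : ∀ {a a′ b b′} → a ~ a′ → b ~ b′ → a * b ~ a′ * b′
  *-cong-~ {a} {a′} {b} {b′} ⟪ p ⟫ ⟪ q ⟫ = ⟪ (begin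
    w * (a * b)    ≈⟨ *-assoc w a b ⟨
    w * a * b      ≈⟨ *-congʳ p ⟩
    w * a′ * b     ≈⟨ *-assoc w a′ b ⟩
    w * (a′ * b)   ≈⟨ x∙yz≈y∙xz w a′ b ⟩
    a′ * (w * b)   ≈⟨ *-congˡ q ⟩
    a′ * (w * b′)  ≈⟨ x∙yz≈y∙xz w a′ b′ ⟨
    w * (a′ * b′)  ∎) ⟫

  isCommutativeRing : IsCommutativeRing _~_ _+_ _*_ -_ 0# 1#
  isCommutativeRing = record
    { isRing = record
      { +-isAbelianGroup = record
        { isGroup = record
          { isMonoid = record
            { isSemigroup = record
              { isMagma = record
                { isEquivalence = record
                  { refl = ⟪ refl ⟫
                  ; sym = λ p → ⟪ sym (*≈* p) ⟫
                  ; trans = λ p q → ⟪ trans (*≈* p) (*≈* q) ⟫ }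
                ; ∙-cong = λ p q → ⟪ trans (distribˡ w _ _) (trans (+-cong (*≈* p) (*≈* q)) (sym (distribˡ w _ _))) ⟫ }
              ; assoc = λ x y z → ≈⇒~ (+-assoc x y z) }
            ; identity = (λ x → ≈⇒~ (+-identityˡ x)) , (λ x → ≈⇒~ (+-identityʳ x)) }
          ; inverse = (λ x → ≈⇒~ (-‿inverseˡ x)) , (λ x → ≈⇒~ (-‿inverseʳ x))
          ; ⁻¹-cong = λ p → ⟪ trans (sym (-‿distribʳ-* w _)) (trans (-‿cong (*≈* p)) (-‿distribʳ-* w _)) ⟫ }
        ; comm = λ x y → ≈⇒~ (+-comm x y) }
      ; *-cong = *-cong-~
      ; *-assoc = λ x y z → ≈⇒~ (*-assoc x y z)
      ; *-identity = (λ x → ≈⇒~ (*-identityˡ x)) , (λ x → ≈⇒~ (*-identityʳ x))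
      ; distrib = (λ x y z → ≈⇒~ (distribˡ x y z)) , (λ x y z → ≈⇒~ (distribʳ x y z)) }
    ; *-comm = λ x y → ≈⇒~ (*-comm x y) }

  localisation : CommutativeRing c ℓ
  localisation = record { isCommutativeRing = isCommutativeRing }

  open import Algebra.Properties.Semiring.Exp semiring using (_^_)
  open import Algebra.Properties.Semiring.Exp (CommutativeRing.semiring localisation)
    using () renaming (_^_ to _^~_)

  -- Not definitional: the carried equality is an argument of the library's exponentiation.
  ^≡^~ : ∀ a k → a ^ k ≡ a ^~ k
  ^≡^~ a zero    = ≡.refl
  ^≡^~ a (suc k) = ≡.cong (a *_) (^≡^~ a k)

module Roots {c ℓ} (R : CommutativeRing c ℓ)
  (1≉0 : ¬ CommutativeRing._≈_ R (CommutativeRing.1# R) (CommutativeRing.0# R)) where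
  open CommutativeRing R hiding (zero)
  open import Algebra.Properties.CommutativeSemiring.Exp commutativeSemiring
  open import Algebra.Properties.Ring ring using (x[y-z]≈xy-xz; [y-z]x≈yx-zx)
  open import Algebra.Properties.Group +-group
    using () renaming (x≈y⇒x∙y⁻¹≈ε to x≈y⇒x-y≈0)
  open import Relation.Binary.Reasoning.Setoid setoid

  -- The ring may have zero divisors, so root counting asks for cancellation only of the differences
  -- that occur.
  Cancellable : Carrier → Set _
  Cancellable a = ∀ {b} → a * b ≈ 0# → b ≈ 0#

  -- The monic polynomial c₀ + c₁ x + … + x^k given by its non-leading coefficients.
  eval : ∀ {k} → Vec Carrier k → Carrier → Carrier
  eval []       x = 1#
  eval (c ∷ cs) x = c + x * eval cs x

  -- Synthetic division by x - t with the remainder dropped; the result is again monic.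
  quotient : ∀ {k} → Vec Carrier (suc k) → Carrier → Vec Carrier k
  quotient (c ∷ [])           t = []
  quotient (c ∷ cs@(_ ∷ _))   t = eval cs t ∷ quotient cs t

  telescope : ∀ a b d → (a - b) + (b - d) ≈ a - d
  telescope a b d = begin
    (a - b) + (b - d)     ≈⟨ +-assoc a (- b) (b - d) ⟩
    a + (- b + (b - d))   ≈⟨ +-congˡ (+-assoc (- b) b (- d)) ⟨
    a + ((- b + b) - d)   ≈⟨ +-congˡ (+-congʳ (-‿inverseˡ b)) ⟩
    a + (0# - d)          ≈⟨ +-congˡ (+-identityˡ (- d)) ⟩
    a - d                 ∎

  [c+a]-[c+b]≈a-b : ∀ c a b → (c + a) - (c + b) ≈ a - b
  [c+a]-[c+b]≈a-b c a b = begin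
    (c + a) - (c + b)     ≈⟨ +-congˡ (-‿cong (+-comm c b)) ⟩
    (c + a) - (b + c)     ≈⟨ +-congʳ (+-comm c a) ⟩
    (a + c) - (b + c)     ≈⟨ +-congˡ (⁻¹-anti-homo-∙ b c) ⟩
    (a + c) + (- c - b)   ≈⟨ +-assoc a c _ ⟩
    a + (c + (- c - b))   ≈⟨ +-congˡ (+-assoc c (- c) (- b)) ⟨
    a + ((c - c) - b)     ≈⟨ +-congˡ (+-congʳ (-‿inverseʳ c)) ⟩
    a + (0# - b)          ≈⟨ +-congˡ (+-identityˡ (- b)) ⟩
    a - b                 ∎
    where open import Algebra.Properties.Group +-group using (⁻¹-anti-homo-∙)

  eval-quotient : ∀ {k} (cs : Vec Carrier (suc k)) x t →
                  eval cs x - eval cs t ≈ (x - t) * eval (quotient cs t) x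
  eval-quotient (c ∷ []) x t = begin
    (c + x * 1#) - (c + t * 1#)  ≈⟨ [c+a]-[c+b]≈a-b c _ _ ⟩
    x * 1# - t * 1#              ≈⟨ [y-z]x≈yx-zx 1# x t ⟨
    (x - t) * 1#                 ∎
  eval-quotient (c ∷ cs@(_ ∷ _)) x t = begin
    (c + x * P x) - (c + t * P t)                ≈⟨ [c+a]-[c+b]≈a-b c _ _ ⟩
    x * P x - t * P t                            ≈⟨ telescope (x * P x) (x * P t) (t * P t) ⟨
    (x * P x - x * P t) + (x * P t - t * P t)    ≈⟨ +-cong (x[y-z]≈xy-xz x _ _) ([y-z]x≈yx-zx (P t) x t) ⟨
    x * (P x - P t) + (x - t) * P t              ≈⟨ +-congʳ (*-congˡ (eval-quotient cs x t)) ⟩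
    x * ((x - t) * Q x) + (x - t) * P t          ≈⟨ +-congʳ (x∙yz≈y∙xz x (x - t) (Q x)) ⟩
    (x - t) * (x * Q x) + (x - t) * P t          ≈⟨ distribˡ (x - t) _ _ ⟨
    (x - t) * (x * Q x + P t)                    ≈⟨ *-congˡ (+-comm _ _) ⟩
    (x - t) * (P t + x * Q x)                    ∎
    where
    P = eval cs
    Q = eval (quotient cs t)
    open import Algebra.Properties.CommutativeSemigroup *-commutativeSemigroup using (x∙yz≈y∙xz)

  eval-quotient-root : ∀ {k} (cs : Vec Carrier (suc k)) {x t} → eval cs x ≈ 0# → eval cs t ≈ 0# →
                       (x - t) * eval (quotient cs t) x ≈ 0#
  eval-quotient-root cs {x} {t} px≈0 pt≈0 =
    trans (sym (eval-quotient cs x t)) (x≈y⇒x-y≈0 (trans px≈0 (sym pt≈0)))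

  -- A monic polynomial of degree `k` has no roots beyond `k` well-separated ones. If `x` is not the
  -- first root, x - t₀ cancels, so `x` and the other given roots are roots of the quotient. At
  -- degree 0 the polynomial is 1 and has no root.
  root-among : ∀ {k} (cs : Vec Carrier k) (t : Fin k → Carrier) →
               (∀ i → eval cs (t i) ≈ 0#) →
               (∀ {i j} → i ≢ j → Cancellable (t i - t j)) →
               ∀ {x} → (∀ i → x ≈ t i ⊎ Cancellable (x - t i)) →
               eval cs x ≈ 0# → ∃ λ i → x ≈ t i
  root-among []           t roots distinct split px≈0 = contradiction px≈0 1≉0
  root-among cs@(_ ∷ _)   t roots distinct split px≈0 with split zero
  ... | inj₁ x≈t₀ = zero , x≈t₀
  ... | inj₂ cancel with root-among (quotient cs (t zero)) (t ∘ suc)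
          (λ i → distinct {suc i} {zero} (λ ()) (eval-quotient-root cs (roots (suc i)) (roots zero)))
          (λ i≢j → distinct λ { ≡.refl → i≢j ≡.refl })
          (split ∘ suc)
          (cancel (eval-quotient-root cs px≈0 (roots zero)))
  ...   | i , x≈ = suc i , x≈

  xⁿ-1 : ∀ m → Vec Carrier (suc m)
  xⁿ-1 m = (- 1#) ∷ replicate m 0#

  eval-replicate-0 : ∀ m x → eval (replicate m 0#) x ≈ x ^ m
  eval-replicate-0 zero x = refl
  eval-replicate-0 (suc m) x = trans (+-identityˡ _) (*-congˡ (eval-replicate-0 m x))

  ^≈1⇒root : ∀ m {x} → x ^ suc m ≈ 1# → eval (xⁿ-1 m) x ≈ 0#
  ^≈1⇒root m {x} x^≈1 = begin
    - 1# + x * eval (replicate m 0#) x ≈⟨ +-congˡ (*-congˡ (eval-replicate-0 m x)) ⟩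
    - 1# + x ^ suc m                   ≈⟨ +-congˡ x^≈1 ⟩
    - 1# + 1#                          ≈⟨ -‿inverseˡ 1# ⟩
    0#                                 ∎

-- `op m b s` plays the role of m s + b.
record TernaryField (q : ℕ) : Set where
  field
    op       : (m b s : Fin q) → Fin q
    b-unique : ∀ m {b b′} s → op m b s ≡ op m b′ s → b ≡ b′
    m-unique : ∀ {m m′ b b′ s t} → s ≢ t →
               op m b s ≡ op m′ b′ s → op m b t ≡ op m′ b′ t → m ≡ m′

-- X has order exactly n in every quotient of R in which u is nonzero.
record RootOfUnity {c ℓ} (R : CommutativeRing c ℓ) (r : ℕ) : Set (c ⊔ ℓ) where
  open CommutativeRing R
  open Exp semiring using (_^_)
  n : ℕ
  n = suc r
  field
    _≟_         : Decidable _≈_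
    fixed       : ∀ a → a ^ suc n ≈ a
    X u         : Carrier
    X^n≈1       : X ^ n ≈ 1#
    u≉0         : ¬ u ≈ 0#
    u-divisible : ∀ {l} d → Prime l → n ≡ d ℕ.* l → ∃ λ v → u ≈ (X ^ d - 1#) * v

-- The field formed by zero and the powers of a root of unity

module Coordinatisation {c ℓ} (R : CommutativeRing c ℓ) {r} (D : RootOfUnity R r) where
  open CommutativeRing R using (Carrier; _≈_; _*_; _-_; 0#; 1#; semiring)
  open Exp semiring using (_^_)
  open RootOfUnity D

  open import Data.List.Membership.Propositional using (_∈_)
  open import Data.List.Membership.Propositional.Properties
    using (∈-cartesianProductWith⁺; ∈-tabulate⁺; ∈-++⁺ˡ; ∈-++⁺ʳ)
  private
    module R = CommutativeRing R
  open R using (_+_)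

  -- The future field elements. Closure under the operations is obtained only modulo the annihilator
  -- of a suitable multiple of `u`.
  τ : Fin (suc n) → Carrier
  τ zero    = 0#
  τ (suc i) = X ^ toℕ i

  module _ where
    open R using (refl; sym; trans; *-congʳ; *-congˡ; *-comm; *-assoc; *-identityʳ; zeroʳ)
    open import Relation.Binary.Reasoning.Setoid R.setoid

    -- Modulo the annihilator of `w`, the element `a` is 0 or an n-th root of unity. Stating this in
    -- the original ring lets `w` vary.
    Split : Carrier → Carrier → Set ℓ
    Split w a = w * a ≈ 0# ⊎ w * a ^ n ≈ w

    -- Multiplying `w` only enlarges its annihilator, so the decisions already made in `select`
    -- persist.
    Split-* : ∀ {w} b {a} → Split w a → Split (w * b) a
    Split-* {w} b {a} (inj₁ wa≈0) = inj₁ (begin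
      w * b * a     ≈⟨ *-congʳ (*-comm w b) ⟩
      b * w * a     ≈⟨ *-assoc b w a ⟩
      b * (w * a)   ≈⟨ *-congˡ wa≈0 ⟩
      b * 0#        ≈⟨ zeroʳ b ⟩
      0#            ∎)
    Split-* {w} b {a} (inj₂ wa≈w) = inj₂ (begin
      w * b * a ^ n     ≈⟨ *-congʳ (*-comm w b) ⟩
      b * w * a ^ n     ≈⟨ *-assoc b w _ ⟩
      b * (w * a ^ n)   ≈⟨ *-congˡ wa≈w ⟩
      b * w             ≈⟨ *-comm b w ⟩
      w * b             ∎)

    -- Since a ^ (n + 1) ≈ a, replacing w by w * a makes a invertible modulo the annihilator of w.
    select : ∀ as → ∃ λ v → ¬ u * v ≈ 0# × All (Split (u * v)) as
    select [] = 1# , (λ u≈0 → u≉0 (trans (sym (*-identityʳ u)) u≈0)) , []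
    select (a ∷ as) with select as
    ... | v , uv≉0 , splits with (u * v * a) ≟ 0#
    ...   | yes uva≈0 = v , uv≉0 , inj₁ uva≈0 ∷ splits
    ...   | no  uva≉0 = v * a
      , (λ u[va]≈0 → uva≉0 (trans (*-assoc u v a) u[va]≈0))
      , resp (inj₂ (trans (*-assoc (u * v) a (a ^ n)) (*-congˡ (fixed a)))) ∷ All.map (resp ∘ Split-* a) splits
      where
      resp : ∀ {b} → Split (u * v * a) b → Split (u * (v * a)) b
      resp = Sum.map (trans (*-congʳ (sym (*-assoc u v a))))
                     (λ p → trans (*-congʳ (sym (*-assoc u v a))) (trans p (*-assoc u v a)))

  module Field (v : Carrier) (uv≉0 : ¬ u * v ≈ 0#)
    (split-difference : ∀ i j → Split (u * v) (τ i - τ j))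
    (split-line : ∀ m b s k → Split (u * v) (τ m * τ s + τ b - τ k))
    where

    private
      uv = u * v

    open Localisation R uv using (⟪_⟫; ≈⇒~; localisation; ^≡^~)

    open CommutativeRing localisation
      hiding (Carrier; _*_; _-_; 0#; 1#; semiring; _+_; zero) renaming (_≈_ to _~_)
    private
      module K = CommutativeRing localisation
    open import Algebra.Properties.Ring K.ring using (x[y-z]≈xy-xz; [y-z]x≈yx-zx)
    open import Algebra.Properties.Group K.+-group
      using () renaming (x∙y⁻¹≈ε⇒x≈y to x-y≈0⇒x≈y; x≈y⇒x∙y⁻¹≈ε to x≈y⇒x-y≈0;
                         ∙-cancelʳ to +-cancelʳ; ∙-cancelˡ to +-cancelˡ)
    open Exp K.semiring using (^-homo-*; ^-assocʳ; ^-congˡ) renaming (_^_ to _^~_)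

    1≁0 : ¬ 1# ~ 0#
    1≁0 ⟪ 1≈0 ⟫ = uv≉0 (R.trans (R.sym (R.*-identityʳ uv)) (R.trans 1≈0 (R.zeroʳ uv)))

    open Roots localisation 1≁0

    -- `fixed` rules out nilpotents: `uv` equals its own power of exponent `suc n`, which contains
    -- the factor `uv * u`.
    u≁0 : ¬ u ~ 0#
    u≁0 ⟪ uvu≈0 ⟫ = uv≉0 (begin
      uv                    ≈⟨ fixed uv ⟨
      uv * (uv * uv ^ r)    ≈⟨ R.*-assoc uv uv _ ⟨
      uv * uv * uv ^ r      ≈⟨ R.*-congʳ (R.*-assoc uv u v) ⟨
      uv * u * v * uv ^ r   ≈⟨ R.*-congʳ (R.*-congʳ (R.trans uvu≈0 (R.zeroʳ uv))) ⟩
      0# * v * uv ^ r       ≈⟨ R.*-congʳ (R.zeroˡ v) ⟩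
      0# * uv ^ r           ≈⟨ R.zeroˡ _ ⟩
      0#                    ∎)
      where open import Relation.Binary.Reasoning.Setoid R.setoid

    open import Relation.Binary.Reasoning.Setoid K.setoid

    X^n~1 : X ^~ n ~ 1#
    X^n~1 = trans (reflexive (≡.sym (^≡^~ X n))) (≈⇒~ X^n≈1)

    -- A smaller exponent would give X^(n/l) ~ 1 for some prime `l`; but `u` is a multiple of
    -- X^(n/l) - 1 and would vanish.
    X^d≁1 : ∀ d .{{_ : NonZero d}} → d < n → ¬ X ^~ d ~ 1#
    X^d≁1 d d<n X^d~1 with Units.^≈1⇒prime-cofactor localisation d X^n~1 d<n X^d~1
    ... | l , k , pr , n≡kl , X^k~1 with u-divisible k pr n≡kl
    ...   | v′ , u≈ = u≁0 (begin
      u                    ≈⟨ ≈⇒~ u≈ ⟩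
      (X ^ k - 1#) * v′    ≡⟨ ≡.cong (λ y → (y - 1#) * v′) (^≡^~ X k) ⟩
      (X ^~ k - 1#) * v′    ≈⟨ *-congʳ (x≈y⇒x-y≈0 X^k~1) ⟩
      0# * v′              ≈⟨ zeroˡ v′ ⟩
      0#                   ∎)

    -- The inverse of `X ^~ i` is `X ^~ (n ∸ i)`.
    X^-cancel : ∀ {i} a → i < n → X ^~ i * a ~ 0# → a ~ 0#
    X^-cancel {i} a i<n X^ia~0 = begin
      a                          ≈⟨ *-identityˡ a ⟨
      1# * a                     ≈⟨ *-congʳ X^n~1 ⟨
      X ^~ n * a                  ≡⟨ ≡.cong (λ k → X ^~ k * a) (ℕ.m∸n+n≡m (ℕ.<⇒≤ i<n)) ⟨
      X ^~ (n ∸ i ℕ.+ i) * a      ≈⟨ *-congʳ (^-homo-* X (n ∸ i) i) ⟩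
      X ^~ (n ∸ i) * X ^~ i * a    ≈⟨ *-assoc _ _ a ⟩
      X ^~ (n ∸ i) * (X ^~ i * a)  ≈⟨ *-congˡ X^ia~0 ⟩
      X ^~ (n ∸ i) * 0#           ≈⟨ zeroʳ _ ⟩
      0#                         ∎

    X^-< : ∀ {i j} → i < j → j < n → ¬ X ^~ i ~ X ^~ j
    X^-< {i} {j} i<j j<n X^i~X^j =
      X^d≁1 (j ∸ i) {{ℕ.>-nonZero (ℕ.m<n⇒0<n∸m i<j)}} (ℕ.≤-<-trans (ℕ.m∸n≤m j i) j<n)
        (x-y≈0⇒x≈y _ _ (X^-cancel _ (ℕ.<-trans i<j j<n) (begin
          X ^~ i * (X ^~ (j ∸ i) - 1#)          ≈⟨ x[y-z]≈xy-xz _ _ _ ⟩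
          X ^~ i * X ^~ (j ∸ i) - X ^~ i * 1#    ≈⟨ +-cong (^-homo-* X i (j ∸ i)) refl ⟨
          X ^~ (i ℕ.+ (j ∸ i)) - X ^~ i * 1#    ≡⟨ ≡.cong (λ k → X ^~ k - X ^~ i * 1#) (ℕ.m+[n∸m]≡n (ℕ.<⇒≤ i<j)) ⟩
          X ^~ j - X ^~ i * 1#                  ≈⟨ +-cong (sym X^i~X^j) (-‿cong (*-identityʳ _)) ⟩
          X ^~ i - X ^~ i                       ≈⟨ -‿inverseʳ _ ⟩
          0#                                  ∎)))

    X^≁0 : ∀ {i} → i < n → ¬ X ^~ i ~ 0#
    X^≁0 i<n X^i~0 = 1≁0 (X^-cancel 1# i<n (trans (*-identityʳ _) X^i~0))

    τ-suc : ∀ i → τ (suc i) ~ X ^~ toℕ i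
    τ-suc i = reflexive (^≡^~ X (toℕ i))

    τ-injective : ∀ {i j} → τ i ~ τ j → i ≡ j
    τ-injective {zero}  {zero}  _   = ≡.refl
    τ-injective {zero}  {suc j} 0~X = contradiction (trans (sym (τ-suc j)) (sym 0~X)) (X^≁0 (toℕ<n j))
    τ-injective {suc i} {zero}  X~0 = contradiction (trans (sym (τ-suc i)) X~0) (X^≁0 (toℕ<n i))
    τ-injective {suc i} {suc j} eq with ℕ.<-cmp (toℕ i) (toℕ j)
    ... | tri< i<j _ _ = contradiction (trans (sym (τ-suc i)) (trans eq (τ-suc j))) (X^-< i<j (toℕ<n j))
    ... | tri≈ _ i≡j _ = ≡.cong suc (toℕ-injective i≡j)
    ... | tri> _ _ j<i = contradiction (trans (sym (τ-suc j)) (trans (sym eq) (τ-suc i))) (X^-< j<i (toℕ<n i))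

    ~0⊎^n~1 : ∀ {a} → Split uv a → a ~ 0# ⊎ a ^~ n ~ 1#
    ~0⊎^n~1 = Sum.map (λ p → ⟪ R.trans p (R.sym (R.zeroʳ uv)) ⟫)
                           (λ p → trans (reflexive (≡.sym (^≡^~ _ n))) ⟪ R.trans p (R.sym (R.*-identityʳ uv)) ⟫)

    -- As `n` is `suc r`, the power `a ^~ r` is an inverse of `a`.
    ^n~1⇒cancellable : ∀ {a} → a ^~ n ~ 1# → Cancellable a
    ^n~1⇒cancellable {a} a^n~1 {b} ab~0 = begin
      b                ≈⟨ *-identityˡ b ⟨
      1# * b           ≈⟨ *-congʳ a^n~1 ⟨
      a * a ^~ r * b    ≈⟨ *-congʳ (*-comm a _) ⟩
      a ^~ r * a * b    ≈⟨ *-assoc _ a b ⟩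
      a ^~ r * (a * b)  ≈⟨ *-congˡ ab~0 ⟩
      a ^~ r * 0#       ≈⟨ zeroʳ _ ⟩
      0#               ∎

    ~⊎cancellable : ∀ {a b} → Split uv (a - b) → a ~ b ⊎ Cancellable (a - b)
    ~⊎cancellable = Sum.map (x-y≈0⇒x≈y _ _) ^n~1⇒cancellable ∘ ~0⊎^n~1

    τ-difference : ∀ {i j} → i ≢ j → Cancellable (τ i - τ j)
    τ-difference {i} {j} i≢j =
      [ (λ eq → contradiction (τ-injective eq) i≢j) , (λ p → p) ]′
        (~⊎cancellable (split-difference i j))

    module _ (m b s : Fin (suc n)) where
      private
        y = τ m * τ s + τ b

        X^-root : ∀ (i : Fin n) → τ (suc i) ^~ n ~ 1#
        X^-root i = begin
          τ (suc i) ^~ n          ≈⟨ ^-congˡ n (τ-suc i) ⟩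
          (X ^~ toℕ i) ^~ n       ≈⟨ ^-assocʳ X (toℕ i) n ⟩
          X ^~ (toℕ i ℕ.* n)     ≈⟨ Units.^-≈1-* localisation n (toℕ i) X^n~1 ⟩
          1#                    ∎

        y-0~y : y - 0# ~ y
        y-0~y = trans (+-cong refl -0#≈0#) (+-identityʳ y)
          where open import Algebra.Properties.Ring K.ring using (-0#≈0#)

      -- A nonzero `y` is a root of Y^n - 1, and the `n` powers of `X` are already all the roots
      -- that `root-among` permits.
      τ-closed : ∃ λ k → y ~ τ k
      -- Since `τ zero` is `0#`, this instance of `split-line` decides `y` itself.
      τ-closed with ~0⊎^n~1 (split-line m b s zero)
      ... | inj₁ y~0 = zero , trans (sym y-0~y) y~0
      ... | inj₂ y^n~1 with root-among (xⁿ-1 r) (τ ∘ suc) (λ i → ^≈1⇒root r (X^-root i))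
              (λ {i} {j} i≢j → τ-difference {suc i} {suc j} λ { ≡.refl → i≢j ≡.refl })
              (λ i → ~⊎cancellable (split-line m b s (suc i)))
              (^≈1⇒root r (trans (^-congˡ n (sym y-0~y)) y^n~1))
      ...   | i , y~τ = suc i , y~τ

    ternary : TernaryField (suc n)
    ternary = record { op = op ; b-unique = b-unique ; m-unique = m-unique }
      where
      op : (m b s : Fin (suc n)) → Fin (suc n)
      op m b s = proj₁ (τ-closed m b s)

      op-~ : ∀ {m b m′ b′} s → op m b s ≡ op m′ b′ s → τ m * τ s + τ b ~ τ m′ * τ s + τ b′
      op-~ {m} {b} {m′} {b′} s eq =
        trans (proj₂ (τ-closed m b s))
          (trans (reflexive (≡.cong τ eq)) (sym (proj₂ (τ-closed m′ b′ s))))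

      b-unique : ∀ m {b b′} s → op m b s ≡ op m b′ s → b ≡ b′
      b-unique m s eq = τ-injective (+-cancelˡ _ _ _ (op-~ s eq))

      -- The right-hand side of the conclusion does not depend on x.
      rearrange : ∀ {a b a′ b′ x} → a * x + b ~ a′ * x + b′ → (a - a′) * x ~ b′ - b
      rearrange {a} {b} {a′} {b′} {x} eq = +-cancelʳ b _ _ (+-cancelˡ (a′ * x) _ _ (begin
        a′ * x + ((a - a′) * x + b)        ≈⟨ +-cong refl (+-cong ([y-z]x≈yx-zx x a a′) refl) ⟩
        a′ * x + (a * x - a′ * x + b)      ≈⟨ +-assoc _ _ _ ⟨
        a′ * x + (a * x - a′ * x) + b      ≈⟨ +-cong (x+[y-x]~y _ _) refl ⟩
        a * x + b                          ≈⟨ eq ⟩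
        a′ * x + b′                        ≈⟨ +-cong refl (x+[y-x]~y b b′) ⟨
        a′ * x + (b + (b′ - b))            ≈⟨ +-cong refl (+-comm b _) ⟩
        a′ * x + (b′ - b + b)              ∎))
        where
        x+[y-x]~y : ∀ x y → x + (y - x) ~ y
        x+[y-x]~y x y = begin
          x + (y - x)     ≈⟨ +-comm x _ ⟩
          y - x + x       ≈⟨ +-assoc y _ x ⟩
          y + (K.- x + x) ≈⟨ +-cong refl (-‿inverseˡ x) ⟩
          y + 0#          ≈⟨ +-identityʳ y ⟩
          y               ∎

      -- By `rearrange`, multiplying τ m - τ m′ by `τ s` or by `τ t` gives the same result; the
      -- nonzero difference of the latter two then cancels.
      m-unique : ∀ {m m′ b b′ s t} → s ≢ t → op m b s ≡ op m′ b′ s → op m b t ≡ op m′ b′ t → m ≡ m′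
      m-unique {m} {m′} {b} {b′} {s} {t} s≢t eq₁ eq₂ =
        τ-injective (x-y≈0⇒x≈y _ _ (τ-difference s≢t (begin
          (τ s - τ t) * (τ m - τ m′)                          ≈⟨ *-comm _ _ ⟩
          (τ m - τ m′) * (τ s - τ t)                          ≈⟨ x[y-z]≈xy-xz _ _ _ ⟩
          (τ m - τ m′) * τ s - (τ m - τ m′) * τ t
            ≈⟨ +-cong (rearrange (op-~ s eq₁)) (-‿cong (rearrange (op-~ t eq₂))) ⟩
          (τ b′ - τ b) - (τ b′ - τ b)                         ≈⟨ -‿inverseʳ _ ⟩
          0#                                                  ∎)))

  -- The list collects the elements that must be decided: differences of candidates, for
  -- distinctness, and differences between a value m s + b and a candidate, for closure.
  ternaryField : TernaryField (suc n)
  ternaryField with select (cartesianProductWith _-_ T T ++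
                            cartesianProductWith _-_ (cartesianProductWith _+_ (cartesianProductWith _*_ T T) T) T)
    where T = tabulate τ
  ... | v , uv≉0 , splits = Field.ternary v uv≉0
    (λ i j → All.lookup splits (∈-++⁺ˡ (∈-cartesianProductWith⁺ _-_ (τ∈T i) (τ∈T j))))
    (λ m b s k → All.lookup splits (∈-++⁺ʳ (cartesianProductWith _-_ (tabulate τ) (tabulate τ))
      (∈-cartesianProductWith⁺ _-_
        (∈-cartesianProductWith⁺ _+_ (∈-cartesianProductWith⁺ _*_ (τ∈T m) (τ∈T s)) (τ∈T b)) (τ∈T k))))
    where
    τ∈T : ∀ i → τ i ∈ tabulate τ
    τ∈T = ∈-tabulate⁺ {f = τ}

-- The prime field, and coordinates of prime power order

module IntegersMod (p : ℕ) where
  open import Data.Integer.Base using (ℤ; +_; _+_; _*_; -_; _-_; 0ℤ; 1ℤ)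
  import Data.Integer.Properties as ℤ
  import Data.Integer.Divisibility.Signed as ℤ∣
  import Data.Integer.Tactic.RingSolver as ℤ-Solver
  open ℤ∣ using () renaming (_∣_ to _∣ℤ_)

  infix 4 _≈_
  -- A record keeps `a` and `b` inferable, which the bare divisibility of their difference would
  -- not.
  record _≈_ (a b : ℤ) : Set where
    constructor ⟪_⟫
    field
      ∣- : + p ∣ℤ a - b
  open _≈_ public

  private
    via : ∀ {a b x} → x ≡ a - b → + p ∣ℤ x → a ≈ b
    via eq p∣x = ⟪ ≡.subst (+ p ∣ℤ_) eq p∣x ⟫

    0-eq : ∀ a → 0ℤ ≡ a - a
    0-eq = ℤ-Solver.solve-∀

    sym-eq : ∀ a b → - (a - b) ≡ b - a
    sym-eq = ℤ-Solver.solve-∀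

    trans-eq : ∀ a b c → (a - b) + (b - c) ≡ a - c
    trans-eq = ℤ-Solver.solve-∀

    +-eq : ∀ a b c d → (a - b) + (c - d) ≡ (a + c) - (b + d)
    +-eq = ℤ-Solver.solve-∀

    *-eq : ∀ a b c d → (a - b) * c + b * (c - d) ≡ a * c - b * d
    *-eq = ℤ-Solver.solve-∀

    neg-eq : ∀ a b → - (a - b) ≡ - a - - b
    neg-eq = ℤ-Solver.solve-∀

  ≡⇒≈ : ∀ {a b} → a ≡ b → a ≈ b
  ≡⇒≈ {a} ≡.refl = via (0-eq a) (ℤ∣.divides 0ℤ ≡.refl)

  isCommutativeRing : IsCommutativeRing _≈_ _+_ _*_ -_ 0ℤ 1ℤ
  isCommutativeRing = record
    { isRing = record
      { +-isAbelianGroup = record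
        { isGroup = record
          { isMonoid = record
            { isSemigroup = record
              { isMagma = record
                { isEquivalence = record
                  { refl = ≡⇒≈ ≡.refl
                  ; sym = λ {a} {b} r → via (sym-eq a b) (ℤ∣.∣m⇒∣-m (∣- r))
                  ; trans = λ {a} {b} {c} r s → via (trans-eq a b c) (ℤ∣.∣m∣n⇒∣m+n (∣- r) (∣- s)) }
                ; ∙-cong = λ {a} {b} {c} {d} r s → via (+-eq a b c d) (ℤ∣.∣m∣n⇒∣m+n (∣- r) (∣- s)) }
              ; assoc = λ a b c → ≡⇒≈ (ℤ.+-assoc a b c) }
            ; identity = (λ a → ≡⇒≈ (ℤ.+-identityˡ a)) , (λ a → ≡⇒≈ (ℤ.+-identityʳ a)) }
          ; inverse = (λ a → ≡⇒≈ (ℤ.+-inverseˡ a)) , (λ a → ≡⇒≈ (ℤ.+-inverseʳ a))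
          ; ⁻¹-cong = λ {a} {b} r → via (neg-eq a b) (ℤ∣.∣m⇒∣-m (∣- r)) }
        ; comm = λ a b → ≡⇒≈ (ℤ.+-comm a b) }
      ; *-cong = λ {a} {b} {c} {d} r s →
          via (*-eq a b c d) (ℤ∣.∣m∣n⇒∣m+n (ℤ∣.∣m⇒∣m*n c (∣- r)) (ℤ∣.∣n⇒∣m*n b (∣- s)))
      ; *-assoc = λ a b c → ≡⇒≈ (ℤ.*-assoc a b c)
      ; *-identity = (λ a → ≡⇒≈ (ℤ.*-identityˡ a)) , (λ a → ≡⇒≈ (ℤ.*-identityʳ a))
      ; distrib = (λ a b c → ≡⇒≈ (ℤ.*-distribˡ-+ a b c)) , (λ a b c → ≡⇒≈ (ℤ.*-distribʳ-+ a b c)) }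
    ; *-comm = λ a b → ≡⇒≈ (ℤ.*-comm a b) }

  ring : CommutativeRing 0ℓ 0ℓ
  ring = record { isCommutativeRing = isCommutativeRing }

  _≟_ : Decidable _≈_
  a ≟ b = map′ ⟪_⟫ ∣- (+ p ℤ∣.∣? (a - b))

  open import Algebra.Properties.Semiring.Mult (CommutativeRing.semiring ring) using () renaming (_×_ to _·_)

  ·≡* : ∀ m a → m · a ≡ + m * a
  ·≡* zero    a = ≡.refl
  ·≡* (suc m) a = ≡.trans (≡.cong (λ b → a + b) (·≡* m a)) (≡.sym (ℤ.suc-* (+ m) a))

  p·≈0 : ∀ a → p · a ≈ 0ℤ
  p·≈0 a = via (≡.sym (ℤ.+-identityʳ (p · a)))
               (ℤ∣.divides a (≡.trans (·≡* p a) (ℤ.*-comm (+ p) a)))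

  1≉0 : Prime p → ¬ 1ℤ ≈ 0ℤ
  1≉0 pr ⟪ p∣1 ⟫ = contradiction (≡.subst Prime (∣1⇒≡1 (ℤ∣.∣⇒∣ᵤ p∣1)) pr) ¬prime[1]

private
  -- Here `r` is q - 2, so the order n = q - 1 of the cyclic group is visibly a successor.
  ternaryField′ : ∀ {p} r e → Prime p → suc (suc r) ≡ p ℕ.^ e → TernaryField (suc (suc r))
  ternaryField′ {p} r e pr q≡p^e =
    Coordinatisation.ternaryField A.ring record
      { _≟_         = A.≈-dec F._≟_
      ; fixed       = fixed
      ; X           = A.X
      ; u           = u
      ; X^n≈1       = A.X^n≈1
      ; u≉0         = λ u≈0 → nonzero (u≈0 0)
      ; u-divisible = λ d prl n≡dl → divisible d prl (s≤s (∣⇒≤ (divides d n≡dl))) n≡dl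
      }
    where
    module F = IntegersMod p
    module A = GroupAlgebra F.ring (suc r)
    -- The bound is n + 1, above every prime divisor of `n`.
    open A.Separator (A.separator (F.1≉0 pr) (suc (suc r)))
    module ≈ = CommutativeRing A.ring
    open Units A.ring using (1^n≈1)
    open Frobenius.FixedPoints A.ring pr (A.characteristic p F.p·≈0) e q≡p^e (≈.zeroˡ (A.𝟘 A.^ suc r))

    -- The fixed points form a subring containing `X`, as X^q = X X^n = X; expressions have no other
    -- generators, the scalars being sums of 1.
    fixed : ∀ a → Fixed a
    fixed A.𝟘         = ≈.zeroˡ (A.𝟘 A.^ suc r)
    fixed A.𝟙         = 1^n≈1 (suc (suc r))
    fixed A.X         = ≈.*-congˡ {A.X} {A.X A.^ suc r} {A.𝟙} A.X^n≈1
    fixed (a A.⊕ b)   = +-fixed {a} {b} (fixed a) (fixed b)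
    fixed (a A.⊗ b)   = *-fixed {a} {b} (fixed a) (fixed b)
    fixed (A.⊖ a)     = -‿fixed {a} (fixed a)

1<p^e : ∀ {p e} → Prime p → 1 ≤ e → 1 < p ℕ.^ e
1<p^e {p} {suc e} pr _ = ℕ.<-≤-trans (ℕ.nonTrivial⇒n>1 p {{prime⇒nonTrivial pr}})
  (ℕ.m≤m*n p (p ℕ.^ e) {{ℕ.m^n≢0 p e {{ℕ.nonTrivial⇒nonZero p {{prime⇒nonTrivial pr}}}}}})

primePower>1 : ∀ {q} → IsPrimePower q → 1 < q
primePower>1 (p , e , pr , 1≤e , ≡.refl) = 1<p^e pr 1≤e

ternaryField : ∀ {q} → IsPrimePower q → TernaryField q
ternaryField {zero}        q-pp                      = contradiction (primePower>1 q-pp) λ ()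
ternaryField {suc zero}    q-pp                      = contradiction (primePower>1 q-pp) λ { (s≤s ()) }
ternaryField {suc (suc r)} (p , e , pr , _ , q≡p^e)  = ternaryField′ r e pr q≡p^e

-- Affine and projective planes

open import Algebra.Properties.Semiring.Sum ℕ.+-*-semiring
open import Data.Fin.Properties
  using (_≟_; suc-injective; inject≤-injective; punchInᵢ≢i; +↔⊎; *↔×)
open import Data.Fin.Subset using (Subset; inside; outside; ∣_∣; _∩_; _∈_; _∉_; ⊥)
open import Data.Fin.Subset.Properties
open import Data.Nat using (ℕ; _≤_; _+_; _*_; suc)
open import Data.Product using (_×_)
open import Data.Sum.Function.Propositional using (_⊎-↔_)
open import Data.Sum.Properties using (inj₁-injective; inj₂-injective)
open import Data.Vec.Base using (_[_]≔_; here; there; lookup)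
open import Data.Vec.Functional using (removeAt)
open import Data.Vec.Properties using (lookup∘update′; []=⇒lookup; lookup⇒[]=)
open import Function.Bundles using (_↔_; module Inverse; Injection)
open import Function.Construct.Composition using (_↔-∘_)
open import Function.Construct.Identity using (↔-id)
open import Function.Definitions using (Injective)
open import Function.Properties.Inverse using (↔⇒↣; ↔-sym)
open import Relation.Binary.PropositionalEquality
  using (refl; sym; trans; cong; cong₂; subst; subst₂)

∣p[x]≔inside∣ : ∀ {n} (p : Subset n) {x} → x ∉ p → ∣ p [ x ]≔ inside ∣ ≡ suc ∣ p ∣
∣p[x]≔inside∣ (outside ∷ p) {zero}  x∉p = refl
∣p[x]≔inside∣ (inside  ∷ p) {zero}  x∉p = contradiction here x∉p
∣p[x]≔inside∣ (outside ∷ p) {suc x} x∉p = ∣p[x]≔inside∣ p (x∉p ∘ there)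
∣p[x]≔inside∣ (inside  ∷ p) {suc x} x∉p = cong suc (∣p[x]≔inside∣ p (x∉p ∘ there))

image : ∀ {k n} → (Fin k → Fin n) → Subset n
image {zero}  g = ⊥
image {suc k} g = image (g ∘ suc) [ g zero ]≔ inside

∈-image⁻ : ∀ {k n} (g : Fin k → Fin n) {y} → y ∈ image g → ∃ λ i → y ≡ g i
∈-image⁻ {zero}  g y∈ = contradiction y∈ ∉⊥
∈-image⁻ {suc k} g {y} y∈ with y ≟ g zero
... | yes y≡g0 = zero , y≡g0
... | no  y≢g0 with ∈-image⁻ (g ∘ suc) (lookup⇒[]= y (image (g ∘ suc))
        (trans (sym (lookup∘update′ y≢g0 (image (g ∘ suc)) inside)) ([]=⇒lookup y∈)))
...   | i , y≡gi = suc i , y≡gi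

∣image∣ : ∀ {k n} (g : Fin k → Fin n) → Injective _≡_ _≡_ g → ∣ image g ∣ ≡ k
∣image∣ {zero}  {n} g inj = ∣⊥∣≡0 n
∣image∣ {suc k} g inj = trans (∣p[x]≔inside∣ (image (g ∘ suc)) g0∉)
  (cong suc (∣image∣ (g ∘ suc) (suc-injective ∘ inj)))
  where
  g0∉ : g zero ∉ image (g ∘ suc)
  g0∉ g0∈ with ∈-image⁻ (g ∘ suc) g0∈
  ... | i , g0≡gi with inj g0≡gi
  ...   | ()

subsingleton⇒∣p∣≤1 : ∀ {n} (p : Subset n) → (∀ {x y} → x ∈ p → y ∈ p → x ≡ y) → ∣ p ∣ ≤ 1
subsingleton⇒∣p∣≤1 {n} p unique with nonempty? p
... | yes (x , x∈p) = subst (∣ p ∣ ≤_) (∣⁅x⁆∣≡1 x)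
        (p⊆q⇒∣p∣≤∣q∣ λ y∈p → subst (_∈ _) (unique x∈p y∈p) (x∈⁅x⁆ x))
... | no ¬nonempty rewrite Empty-unique ¬nonempty | ∣⊥∣≡0 n = z≤n

-- `meet` expresses in parameters that distinct lines share at most one point. Distinct lines also
-- have distinct blocks, because equal blocks would meet in `k` > 1 points.
linearSpace⇒admissible : ∀ {n m k} {Point Line : Set} (g : Line → Fin k → Point) →
  (∀ l → Injective _≡_ _≡_ (g l)) →
  (∀ {l l′} → l ≢ l′ → ∀ {s t s′ t′} → g l s ≡ g l′ s′ → g l t ≡ g l′ t′ → s ≡ t) →
  (point : Point → Fin n) → Injective _≡_ _≡_ point →
  (line : Fin m → Line) → Injective _≡_ _≡_ line →
  1 < k → Admissible n m k
linearSpace⇒admissible {n} {m} {k} g g-inj meet point point-inj line line-inj 1<k =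
  F , F-injective , card , meet≤1
  where
  f : Fin m → Fin k → Fin n
  f i = point ∘ g (line i)

  F : Fin m → Subset n
  F i = image (f i)

  card : ∀ i → ∣ F i ∣ ≡ k
  card i = ∣image∣ (f i) (g-inj (line i) ∘ point-inj)

  meet≤1 : ∀ i j → i ≢ j → ∣ F i ∩ F j ∣ ≤ 1
  meet≤1 i j i≢j = subsingleton⇒∣p∣≤1 (F i ∩ F j) unique
    where
    unique : ∀ {x y} → x ∈ F i ∩ F j → y ∈ F i ∩ F j → x ≡ y
    unique x∈ y∈ with x∈p∩q⁻ (F i) (F j) x∈ | x∈p∩q⁻ (F i) (F j) y∈
    ... | x∈i , x∈j | y∈i , y∈j
      with ∈-image⁻ (f i) x∈i | ∈-image⁻ (f j) x∈j | ∈-image⁻ (f i) y∈i | ∈-image⁻ (f j) y∈j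
    ... | s , refl | s′ , eq | t , refl | t′ , eq′ =
      cong (f i) (meet (i≢j ∘ line-inj) (point-inj eq) (point-inj eq′))

  F-injective : Injective _≡_ _≡_ F
  F-injective {i} {j} Fi≡Fj with i ≟ j
  ... | yes i≡j = i≡j
  ... | no  i≢j = contradiction 1<k (ℕ.≤⇒≯ (subst (_≤ 1) ∣Fi∩Fj∣≡k (meet≤1 i j i≢j)))
    where
    ∣Fi∩Fj∣≡k : ∣ F i ∩ F j ∣ ≡ k
    ∣Fi∩Fj∣≡k = trans (cong (λ p → ∣ F i ∩ p ∣) (sym Fi≡Fj)) (trans (cong ∣_∣ (∩-idem (F i))) (card i))

module Planes {q} (K : TernaryField q) (1<q : 1 < q) where
  open TernaryField K

  private
    F = Fin q

  AffineLine : Set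
  AffineLine = F × F ⊎ F

  affine : AffineLine → F → F × F
  affine (inj₁ (m , b)) s = s , op m b s
  affine (inj₂ c)       s = c , s

  -- The parallel class, serving later as the point at infinity: a slope, or the single vertical
  -- direction.
  direction : AffineLine → F ⊎ Fin 1
  direction (inj₁ (m , b)) = inj₁ m
  direction (inj₂ c)       = inj₂ zero

  affine-injective : ∀ l → Injective _≡_ _≡_ (affine l)
  affine-injective (inj₁ _) eq = cong proj₁ eq
  affine-injective (inj₂ _) eq = cong proj₂ eq

  parallel : ∀ {l l′ s s′} → direction l ≡ direction l′ → affine l s ≡ affine l′ s′ → l ≡ l′
  parallel {inj₁ (m , b)} {inj₁ (m′ , b′)} {s} {s′} refl eq with cong proj₁ eq
  ... | refl = cong (λ b → inj₁ (m , b)) (b-unique m s (cong proj₂ eq))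
  parallel {inj₂ c} {inj₂ c′} refl eq = cong (inj₂ ∘ proj₁) eq

  -- Two sloped lines through two common points have equal slope by `m-unique` and coincide by
  -- `parallel`; a vertical line fixes the first coordinate, which parametrises a sloped one.
  affine-meet : ∀ {l l′} → l ≢ l′ → ∀ {s t s′ t′} →
                affine l s ≡ affine l′ s′ → affine l t ≡ affine l′ t′ → s ≡ t
  affine-meet {inj₁ (m , b)} {inj₁ (m′ , b′)} l≢l′ {s} {t} eq eq′ with s ≟ t
  ... | yes s≡t = s≡t
  ... | no  s≢t with cong proj₁ eq | cong proj₁ eq′
  ...   | refl | refl = contradiction
            (parallel (cong inj₁ (m-unique s≢t (cong proj₂ eq) (cong proj₂ eq′))) eq) l≢l′
  affine-meet {inj₁ _} {inj₂ c} l≢l′ eq eq′ = trans (cong proj₁ eq) (sym (cong proj₁ eq′))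
  affine-meet {inj₂ c} {inj₁ _} l≢l′ {s} {t} {s′} {t′} eq eq′
    with cong proj₁ eq | cong proj₁ eq′
  ... | refl | refl = trans (cong proj₂ eq) (sym (cong proj₂ eq′))
  affine-meet {inj₂ c} {inj₂ c′} l≢l′ eq eq′ = contradiction (cong (inj₂ ∘ proj₁) eq) l≢l′

  -- Points and lines of the projective plane: affine ones first, then the ones at infinity.
  ProjectivePoint ProjectiveLine : Set
  ProjectivePoint = F × F ⊎ (F ⊎ Fin 1)
  ProjectiveLine  = AffineLine ⊎ Fin 1

  infinity : Fin (suc q) → F ⊎ Fin 1
  infinity zero    = inj₂ zero
  infinity (suc m) = inj₁ m

  projective : ProjectiveLine → Fin (suc q) → ProjectivePoint
  projective (inj₁ l) zero    = inj₂ (direction l)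
  projective (inj₁ l) (suc s) = inj₁ (affine l s)
  projective (inj₂ _) s       = inj₂ (infinity s)

  infinity-injective : Injective _≡_ _≡_ infinity
  infinity-injective {zero}  {zero}  _    = refl
  infinity-injective {suc m} {suc m} refl = refl

  projective-injective : ∀ l → Injective _≡_ _≡_ (projective l)
  projective-injective (inj₁ l) {zero}  {zero}  eq = refl
  projective-injective (inj₁ l) {suc s} {suc t} eq = cong suc (affine-injective l (inj₁-injective eq))
  projective-injective (inj₂ _) eq = infinity-injective (inj₂-injective eq)

  -- A common point at infinity means equal directions, so a further common affine point would make
  -- the lines equal by `parallel`. The line at infinity contains just one point of each affine
  -- line.
  projective-meet : ∀ {l l′} → l ≢ l′ → ∀ {s t s′ t′} →
    projective l s ≡ projective l′ s′ → projective l t ≡ projective l′ t′ → s ≡ t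
  projective-meet {inj₁ l} {inj₁ l′} l≢l′ {zero}  {zero}  {zero}  {zero}  eq eq′ = refl
  projective-meet {inj₁ l} {inj₁ l′} l≢l′ {zero}  {suc t} {zero}  {suc t′} eq eq′ =
    contradiction (cong inj₁ (parallel (inj₂-injective eq) (inj₁-injective eq′))) l≢l′
  projective-meet {inj₁ l} {inj₁ l′} l≢l′ {suc s} {zero}  {suc s′} {zero}  eq eq′ =
    contradiction (cong inj₁ (parallel (inj₂-injective eq′) (inj₁-injective eq))) l≢l′
  projective-meet {inj₁ l} {inj₁ l′} l≢l′ {suc s} {suc t} {suc s′} {suc t′} eq eq′ =
    cong suc (affine-meet (l≢l′ ∘ cong inj₁) (inj₁-injective eq) (inj₁-injective eq′))
  projective-meet {inj₁ l} {inj₂ _} l≢l′ {zero} {zero} eq eq′ = refl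
  projective-meet {inj₂ _} {inj₁ l} l≢l′ {s} {t} {zero} {zero} eq eq′ =
    infinity-injective (inj₂-injective (trans eq (sym eq′)))
  projective-meet {inj₂ zero} {inj₂ zero} l≢l′ eq eq′ = contradiction refl l≢l′

  affineLines↔ : Fin (q * q + q) ↔ AffineLine
  affineLines↔ = (*↔× ⊎-↔ ↔-id F) ↔-∘ +↔⊎

  projectiveLines↔ : Fin (q * q + q + 1) ↔ ProjectiveLine
  projectiveLines↔ = (affineLines↔ ⊎-↔ ↔-id (Fin 1)) ↔-∘ +↔⊎

  projectivePoints↔ : Fin (q * q + (q + 1)) ↔ ProjectivePoint
  projectivePoints↔ = (*↔× ⊎-↔ +↔⊎) ↔-∘ +↔⊎

  private
    to-injective : ∀ {A B : Set} (i : A ↔ B) → Injective _≡_ _≡_ (Inverse.to i)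
    to-injective i = Injection.injective (↔⇒↣ i)

    from-injective : ∀ {A B : Set} (i : A ↔ B) → Injective _≡_ _≡_ (Inverse.from i)
    from-injective i = to-injective (↔-sym i)

  -- Extra points stay uncovered and surplus lines are discarded, so one plane serves the whole
  -- range of `n`.
  affinePlane : ∀ {n m} → q * q ≤ n → m ≤ q * q + q → Admissible n m q
  affinePlane q²≤n m≤q²+q = linearSpace⇒admissible affine affine-injective affine-meet
    (λ P → inject≤ (Inverse.from *↔× P) q²≤n)
    (λ eq → from-injective *↔× (inject≤-injective q²≤n q²≤n _ _ eq))
    (λ i → Inverse.to affineLines↔ (inject≤ i m≤q²+q))
    (λ eq → inject≤-injective m≤q²+q m≤q²+q _ _ (to-injective affineLines↔ eq))
    1<q

  projectivePlane : Admissible (q * q + q + 1) (q * q + q + 1) (q + 1)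
  projectivePlane = subst₂ (λ n k → Admissible n (q * q + q + 1) k)
    (sym (ℕ.+-assoc (q * q) q 1)) (ℕ.+-comm 1 q)
    (linearSpace⇒admissible projective projective-injective projective-meet
      (Inverse.from projectivePoints↔) (from-injective projectivePoints↔)
      (Inverse.to projectiveLines↔) (to-injective projectiveLines↔)
      (ℕ.m≤n⇒m≤1+n 1<q))

-- Upper bound

χ : Bool → ℕ
χ true  = 1
χ false = 0

χ≤1 : ∀ b → χ b ≤ 1
χ≤1 true  = s≤s z≤n
χ≤1 false = z≤n

χ-idem : ∀ b → χ b * χ b ≡ χ b
χ-idem true  = refl
χ-idem false = refl

∣p∣≡∑χ : ∀ {n} (p : Subset n) → ∣ p ∣ ≡ ∑[ x < n ] χ (lookup p x)
∣p∣≡∑χ []            = refl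
∣p∣≡∑χ (true  ∷ p) = cong suc (∣p∣≡∑χ p)
∣p∣≡∑χ (false ∷ p) = ∣p∣≡∑χ p

sum-mono-≤ : ∀ {n} {f g : Fin n → ℕ} → (∀ i → f i ≤ g i) → sum f ≤ sum g
sum-mono-≤ {zero}  f≤g = z≤n
sum-mono-≤ {suc n} f≤g = ℕ.+-mono-≤ (f≤g zero) (sum-mono-≤ (f≤g ∘ suc))

sum-const : ∀ n c → ∑[ i < n ] c ≡ n * c
sum-const zero    c = refl
sum-const (suc n) c = cong (c +_) (sum-const n c)

sum≤1 : ∀ {n} (f : Fin n → ℕ) → (∀ i → f i ≤ 1) → (∀ {i j} → i ≢ j → f i ≡ 0 ⊎ f j ≡ 0) → sum f ≤ 1
sum≤1 {zero}  f f≤1 disjoint = z≤n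
sum≤1 {suc n} f f≤1 disjoint with f zero ℕ.≟ 0
... | yes f0≡0 rewrite f0≡0 = sum≤1 (f ∘ suc) (f≤1 ∘ suc) (λ i≢j → disjoint λ { refl → i≢j refl })
... | no  f0≢0 = subst (_≤ 1) (sym f0+rest≡f0) (f≤1 zero)
  where
  rest≡0 : ∀ i → f (suc i) ≡ 0
  rest≡0 i with disjoint {zero} {suc i} (λ ())
  ... | inj₁ f0≡0 = contradiction f0≡0 f0≢0
  ... | inj₂ fi≡0 = fi≡0
  f0+rest≡f0 : sum f ≡ f zero
  f0+rest≡f0 = trans (cong (f zero +_) (trans (sum-cong-≗ rest≡0) (sum-replicate-zero n))) (ℕ.+-identityʳ (f zero))

-- The n - 1 entries away from `x` contribute at most 1 each; the 1 on the left avoids subtraction.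
1+sum≤ : ∀ {n} (f : Fin n → ℕ) x → (∀ {y} → y ≢ x → f y ≤ 1) → 1 + sum f ≤ f x + n
1+sum≤ {suc n} f x f≤1 = begin
  1 + sum f                        ≡⟨ cong suc (sum-remove f) ⟩
  1 + (f x + sum (removeAt f x))   ≤⟨ s≤s (ℕ.+-monoʳ-≤ (f x) (sum-mono-≤ {g = λ _ → 1} λ j → f≤1 (punchInᵢ≢i x j))) ⟩
  1 + (f x + sum {n} (λ _ → 1))    ≡⟨ cong (λ z → 1 + (f x + z)) (trans (sum-const n 1) (ℕ.*-identityʳ n)) ⟩
  1 + (f x + n)                    ≡⟨ ℕ.+-suc (f x) n ⟨
  f x + suc n                      ∎
  where open ℕ.≤-Reasoning

two-elements : ∀ {n} (p : Subset n) {x y} → x ≢ y → x ∈ p → y ∈ p → 1 < ∣ p ∣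
two-elements p {x} {y} x≢y x∈p y∈p = ℕ.≤-<-trans
  (ℕ.≤-<-trans z≤n (x∈p⇒∣p-x∣<∣p∣ (x∈p∧x≢y⇒x∈p-y x∈p x≢y)))
  (x∈p⇒∣p-x∣<∣p∣ y∈p)

-- Of the m k² triples, m k lie on the diagonal x = y, and each of the n (n - 1) other pairs lies in
-- at most one block. Moving `n` to the left keeps the inequality in ℕ.
count-incidences : ∀ {n m k} → Admissible n m k → n + m * (k * k) ≤ m * k + n * n
count-incidences {n} {m} {k} (F , _ , card , meet) = begin
  n + m * (k * k)
    ≡⟨ cong₂ _+_ (sym (trans (sum-const n 1) (ℕ.*-identityʳ n))) triples ⟩
  ∑[ x < n ] 1 + ∑[ x < n ] ∑[ y < n ] pairs x y         ≡⟨ ∑-distrib-+ {n} (λ _ → 1) _ ⟨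
  ∑[ x < n ] (1 + ∑[ y < n ] pairs x y)                  ≤⟨ sum-mono-≤ (λ x → 1+sum≤ (pairs x) x (pairs≤1 x)) ⟩
  ∑[ x < n ] (pairs x x + n)                             ≡⟨ ∑-distrib-+ {n} _ (λ _ → n) ⟩
  ∑[ x < n ] pairs x x + ∑[ x < n ] n                    ≡⟨ cong₂ _+_ diagonal (sum-const n n) ⟩
  m * k + n * n                                          ∎
  where
  open ℕ.≤-Reasoning

  a : Fin m → Fin n → ℕ
  a i x = χ (lookup (F i) x)

  pairs : Fin n → Fin n → ℕ
  pairs x y = ∑[ i < m ] (a i x * a i y)

  row : ∀ i → ∑[ x < n ] a i x ≡ k
  row i = trans (sym (∣p∣≡∑χ (F i))) (card i)

  triples : m * (k * k) ≡ ∑[ x < n ] ∑[ y < n ] pairs x y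
  triples = begin-equality
    m * (k * k)                                         ≡⟨ sum-const m (k * k) ⟨
    ∑[ i < m ] (k * k)                                  ≡⟨ sum-cong-≗ (λ i → sym (cong₂ _*_ (row i) (row i))) ⟩
    ∑[ i < m ] (sum (a i) * sum (a i))                  ≡⟨ sum-cong-≗ (λ i → *-distribʳ-sum (sum (a i)) (a i)) ⟩
    ∑[ i < m ] ∑[ x < n ] (a i x * sum (a i))           ≡⟨ sum-cong-≗ (λ i → sum-cong-≗ λ x → *-distribˡ-sum (a i x) (a i)) ⟩
    ∑[ i < m ] ∑[ x < n ] ∑[ y < n ] (a i x * a i y)    ≡⟨ ∑-comm (λ i x → ∑[ y < n ] (a i x * a i y)) ⟩
    ∑[ x < n ] ∑[ i < m ] ∑[ y < n ] (a i x * a i y)    ≡⟨ sum-cong-≗ (λ x → ∑-comm (λ i y → a i x * a i y)) ⟩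
    ∑[ x < n ] ∑[ y < n ] pairs x y                     ∎

  diagonal : ∑[ x < n ] pairs x x ≡ m * k
  diagonal = begin-equality
    ∑[ x < n ] ∑[ i < m ] (a i x * a i x)   ≡⟨ sum-cong-≗ (λ x → sum-cong-≗ λ i → χ-idem (lookup (F i) x)) ⟩
    ∑[ x < n ] ∑[ i < m ] a i x             ≡⟨ ∑-comm (λ x i → a i x) ⟩
    ∑[ i < m ] ∑[ x < n ] a i x             ≡⟨ sum-cong-≗ row ⟩
    ∑[ i < m ] k                            ≡⟨ sum-const m k ⟩
    m * k                                   ∎

  zero-or-∈ : ∀ i x y → a i x * a i y ≡ 0 ⊎ x ∈ F i × y ∈ F i
  zero-or-∈ i x y with lookup (F i) x in eqx | lookup (F i) y in eqy
  ... | false | _     = inj₁ refl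
  ... | true  | false = inj₁ refl
  ... | true  | true  = inj₂ (lookup⇒[]= x (F i) eqx , lookup⇒[]= y (F i) eqy)

  pairs≤1 : ∀ x {y} → y ≢ x → pairs x y ≤ 1
  pairs≤1 x {y} y≢x = sum≤1 _ (λ i → ℕ.*-mono-≤ (χ≤1 (lookup (F i) x)) (χ≤1 (lookup (F i) y))) disjoint
    where
    disjoint : ∀ {i j} → i ≢ j → a i x * a i y ≡ 0 ⊎ a j x * a j y ≡ 0
    disjoint {i} {j} i≢j with zero-or-∈ i x y | zero-or-∈ j x y
    ... | inj₁ i≡0        | _              = inj₁ i≡0
    ... | inj₂ _          | inj₁ j≡0       = inj₂ j≡0
    ... | inj₂ (x∈i , y∈i) | inj₂ (x∈j , y∈j) = contradiction (meet i j i≢j)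
      (ℕ.<⇒≱ (two-elements (F i ∩ F j) y≢x (x∈p∩q⁺ (y∈i , y∈j)) (x∈p∩q⁺ (x∈i , x∈j))))

-- With as many blocks as points, a factor `n` cancels from the count, and then the summand `suc j`.
admissible⇒bound : ∀ {n j} → 1 ≤ n → Admissible n n (suc j) → j * j + j + 1 ≤ n
admissible⇒bound {n} {j} 1≤n adm = ℕ.+-cancelʳ-≤ (suc j) (j * j + j + 1) n
  (ℕ.*-cancelˡ-≤ n {{ℕ.>-nonZero 1≤n}} (subst₂ _≤_ lhs rhs (count-incidences adm)))
  where
  open +-*-Solver
  lhs : n + n * (suc j * suc j) ≡ n * (j * j + j + 1 + suc j)
  lhs = solve 2 (λ n j → n :+ n :* ((con 1 :+ j) :* (con 1 :+ j)) := n :* (j :* j :+ j :+ con 1 :+ (con 1 :+ j))) refl n j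
  rhs : n * suc j + n * n ≡ n * (n + suc j)
  rhs = solve 2 (λ n j → n :* (con 1 :+ j) :+ n :* n := n :* (n :+ (con 1 :+ j))) refl n j

-- If k - 1 ≥ q, monotonicity of t² + t + 1 and the previous bound force n ≥ q² + q + 1.
admissible⇒k≤ : ∀ {n q k} → 1 ≤ n → n < q * q + q + 1 → Admissible n n k → k ≤ q
admissible⇒k≤ {k = zero} _ _ _ = z≤n
admissible⇒k≤ {n} {q} {suc j} 1≤n n< adm = ℕ.≰⇒> λ q≤j → ℕ.<⇒≱ n<
  (ℕ.≤-trans (ℕ.+-monoˡ-≤ 1 (ℕ.+-mono-≤ (ℕ.*-mono-≤ q≤j q≤j) q≤j)) (admissible⇒bound 1≤n adm))

theorem3p5 : (q n : ℕ) → IsPrimePower q → 1 ≤ n →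
    ((q * q ≤ n × n ≤ q * q + q) → IsKappa≤1 n n q)
    × (n ≡ q * q + q + 1 → IsKappa≤1 n n (q + 1))
theorem3p5 q n q-pp 1≤n =
  (λ (q²≤n , n≤q²+q) →
    affinePlane q²≤n n≤q²+q ,
    λ _ → admissible⇒k≤ 1≤n (subst (n <_) (ℕ.+-comm 1 (q * q + q)) (s≤s n≤q²+q))) ,
  λ { refl → projectivePlane , λ _ → admissible⇒k≤ 1≤n next }
  where
  open Planes (ternaryField q-pp) (primePower>1 q-pp)

  q<q+1 : q < q + 1
  q<q+1 = ℕ.m<m+n q (s≤s z≤n)

  -- Since t² + t + 1 increases strictly, `n` lies below its value at `q + 1`, so the same bound
  -- yields k ≤ q + 1.
  next : q * q + q + 1 < (q + 1) * (q + 1) + (q + 1) + 1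
  next = ℕ.+-monoˡ-< 1 (ℕ.+-mono-≤-< (ℕ.*-mono-≤ (ℕ.<⇒≤ q<q+1) (ℕ.<⇒≤ q<q+1)) q<q+1)
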